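{- Let $k\mid n$. A set $\Pi$ of affine points of $\Sigma=\mathrm{PG}(2n,q)$ is the image under $\phi$ of the set of affine points of an $\mathbb{F}_{q^k}$-subplane of $\mathrm{PG}(2,q^n)$ secant to $l_\infty$ if and only if (i) $\Pi$ is a $2k$-dimensional affine subspace, and (ii) $\bar\Pi\cap H_\infty$ is a $(2k-1)$-dimensional subspace meeting exactly $q^k+1$ elements of $\mathcal D$, each in a $(k-1)$-dimensional subspace. Moreover, in that case $\bar\Pi\cap H_\infty$ meets each of these $q^k+1$ elements of $\mathcal D$ in an element of $\mathcal D_k$.
   Context: Let $q$ be a prime power and $n\ge1$. Points of $\mathrm{PG}(2,q^n)$ are written $(a,b,c)_{\mathbb{F}_{q^n}}$; $l_\infty$ is the line $c=0$; points off $l_\infty$ are affine. For $k\mid n$, an $\mathbb{F}_{q^k}$-subplane is a set $\{(su+tv+wz)_{\mathbb{F}_{q^n}}:(s,t,w)\in\mathbb{F}_{q^k}^3\setminus\{0\}\}$ for $\mathbb{F}_{q^n}$-independent $u,v,z\in\mathbb{F}_{q^n}^3$; it is secant to $l_\infty$ if it meets $l_\infty$ in $q^k+1$ points. Let $\Sigma=\mathrm{PG}(2n,q)$ be the projective space of the $\mathbb{F}_q$-vector space $\mathbb{F}_{q^n}\times\mathbb{F}_{q^n}\times\mathbb{F}_q$, points $(a,b,c)_{\mathbb{F}_q}$; $H_\infty$ is the hyperplane $c=0$, points off it are affine. An affine subspace is the set of affine points of a projective subspace not contained in $H_\infty$, with projective completion $\bar\Pi$. For $k\mid n$, $\mathcal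 D_k=\{\{(ax,bx,0)_{\mathbb{F}_q}:x\in\mathbb{F}_{q^k}^*\}:(a,b)\in\mathbb{F}_{q^n}^2\setminus\{(0,0)\}\}$, $\mathcal D=\mathcal D_n$. The ABB-map $\phi$ sends an affine point $(a,b,1)_{\mathbb{F}_{q^n}}$ to $(a,b,1)_{\mathbb{F}_q}$. -}

module Defs where

open import Level using (Level; 0ℓ; _⊔_)
open import Algebra.Bundles using (CommutativeRing)
open import Algebra.Module.Bundles using (Module)
import Algebra.Module.Construct.DirectProduct as DirectProduct
import Algebra.Module.Construct.TensorUnit as TensorUnit
import Algebra.Properties.CommutativeMonoid.Sum as Sum
open import Data.Fin.Base using (Fin)
open import Data.Nat.Base as ℕ using (ℕ; suc; pred)
open import Data.Nat.Primality using (Prime)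
open import Data.Product.Base using (_×_; _,_; ∃; ∃₂; proj₁; proj₂)
open import Data.Unit.Base using (⊤; tt)
open import Function.Bundles using (Bijection)
open import Relation.Binary.Bundles using (Setoid)
open import Relation.Binary.Core using (Rel)
open import Relation.Binary.Structures using (IsEquivalence)
import Relation.Binary.Construct.On as On
open import Relation.Binary.PropositionalEquality as ≡ using (_≡_)
open import Relation.Nullary.Negation using (¬_)
open import Relation.Unary using (Pred; _∈_; _⊆_; _≐_; _∩_; _≬_; ∁; U)
open import Relation.Unary.Relation.Binary.Equality using (≐-setoid)

PrimePower : ℕ → Set
PrimePower q = ∃₂ λ p e → Prime p × 1 ℕ.≤ e × q ≡ p ℕ.^ e

-- The subset P of S has exactly N elements, counted up to the equality of S.
HasCard : ∀ {a ℓ p : Level} (S : Setoid a ℓ) → Pred (Setoid.Carrier S) p → ℕ → Set (a ⊔ ℓ ⊔ p)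
HasCard S P N = Bijection (≡.setoid (Fin N)) (On.setoid S (proj₁ {B = P}))

record Field : Set₁ where
  field
    commutativeRing : CommutativeRing 0ℓ 0ℓ
  open CommutativeRing commutativeRing public
  field
    1≉0     : ¬ (1# ≈ 0#)
    inverse : ∀ x → ¬ (x ≈ 0#) → ∃ λ y → x * y ≈ 1#

record Subfield (L : Field) : Set₁ where
  open Field L
  field
    Mem   : Pred Carrier 0ℓ
    resp  : ∀ {x y} → x ≈ y → x ∈ Mem → y ∈ Mem
    0∈    : 0# ∈ Mem
    1∈    : 1# ∈ Mem
    +-∈   : ∀ {x y} → x ∈ Mem → y ∈ Mem → x + y ∈ Mem
    *-∈   : ∀ {x y} → x ∈ Mem → y ∈ Mem → x * y ∈ Mem
    neg-∈ : ∀ {x} → x ∈ Mem → - x ∈ Mem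
    inv-∈ : ∀ {x y} → x ∈ Mem → x * y ≈ 1# → y ∈ Mem

HasOrder : (L : Field) → Subfield L → ℕ → Set
HasOrder L K = HasCard (Field.setoid L) (Subfield.Mem K)

whole : (L : Field) → Subfield L
whole L = record
  { Mem = U ; resp = λ _ _ → tt ; 0∈ = tt ; 1∈ = tt ; +-∈ = λ _ _ → tt
  ; *-∈ = λ _ _ → tt ; neg-∈ = λ _ → tt ; inv-∈ = λ _ _ → tt }

-- Both projective spaces live over L³: PG(2,qⁿ) comes from L³ as a vector
-- space over L, and PG(2n,q) from {(a , b , c) ∈ L³ | c ∈ F_q} as a vector
-- space over the subfield F_q.
L³ : (L : Field) → Module (Field.commutativeRing L) 0ℓ 0ℓ
L³ L = DirectProduct.⟨module⟩ L¹ (DirectProduct.⟨module⟩ L¹ L¹)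
  where L¹ = TensorUnit.⟨module⟩ {R = Field.commutativeRing L}

module LinearAlgebra (L : Field) (K : Subfield L) where
  open Field L
  open Subfield K
  open Module (L³ L)

  record Subspace : Set₁ where
    field
      Vectors : Pred Carrierᴹ 0ℓ
      respᴹ  : ∀ {u v} → u ≈ᴹ v → u ∈ Vectors → v ∈ Vectors
      0ᴹ∈    : 0ᴹ ∈ Vectors
      +ᴹ-∈   : ∀ {u v} → u ∈ Vectors → v ∈ Vectors → u +ᴹ v ∈ Vectors
      *ₗ-∈   : ∀ {s u} → s ∈ Mem → u ∈ Vectors → s *ₗ u ∈ Vectors

  combination : ∀ {m} → (Fin m → Carrier) → (Fin m → Carrierᴹ) → Carrierᴹ
  combination s e = Sum.sum +ᴹ-commutativeMonoid (λ i → s i *ₗ e i)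

  Independent : ∀ {m} → (Fin m → Carrierᴹ) → Set
  Independent e = ∀ s → (∀ i → s i ∈ Mem) → combination s e ≈ᴹ 0ᴹ → ∀ i → s i ≈ 0#

  HasDim : Subspace → ℕ → Set
  HasDim W m = ∃ λ (e : Fin m → Carrierᴹ) →
    (∀ i → e i ∈ Subspace.Vectors W) ×
    Independent e ×
    (∀ v → v ∈ Subspace.Vectors W → ∃ λ s → (∀ i → s i ∈ Mem) × v ≈ᴹ combination s e)

  infix 4 _∼_

  _∼_ : Rel Carrierᴹ 0ℓ
  u ∼ v = ∃ λ s → s ∈ Mem × ¬ (s ≈ 0#) × u ≈ᴹ s *ₗ v

  ∼-isEquivalence : IsEquivalence _∼_
  ∼-isEquivalence = record
    { refl  = 1# , 1∈ , 1≉0 , ≈ᴹ-sym (*ₗ-identityˡ _)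
    ; sym   = λ {u} {v} (s , s∈ , s≉0 , u≈sv) →
        let (t , st≈1) = inverse s s≉0
            ts≈1       = trans (*-comm t s) st≈1
        in t , inv-∈ s∈ st≈1
         , (λ t≈0 → 1≉0 (trans (sym st≈1) (trans (*-congˡ t≈0) (zeroʳ s))))
         , ≈ᴹ-trans (≈ᴹ-sym (*ₗ-identityˡ v))
             (≈ᴹ-trans (*ₗ-cong (sym ts≈1) ≈ᴹ-refl)
               (≈ᴹ-trans (*ₗ-assoc t s v) (*ₗ-cong refl (≈ᴹ-sym u≈sv))))
    ; trans = λ {u} {v} {w} (s , s∈ , s≉0 , u≈sv) (t , t∈ , t≉0 , v≈tw) →
        let (s′ , ss′≈1) = inverse s s≉0
        in s * t , *-∈ s∈ t∈
         , (λ st≈0 → t≉0 (trans (sym (*-identityˡ t))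
             (trans (*-congʳ (trans (sym ss′≈1) (*-comm s s′)))
               (trans (*-assoc s′ s t) (trans (*-congˡ st≈0) (zeroʳ s′))))))
         , ≈ᴹ-trans u≈sv (≈ᴹ-trans (*ₗ-cong refl v≈tw) (≈ᴹ-sym (*ₗ-assoc s t w)))
    }

module Projective (L : Field) (K : Subfield L) (V : LinearAlgebra.Subspace L K) where
  open Field L
  open Module (L³ L)
  open LinearAlgebra L K

  -- A representative; points are compared by _≈ᴾ_, not by _≡_.
  record Point : Set where
    constructor point
    field
      vec     : Carrierᴹ
      vec∈    : vec ∈ Subspace.Vectors V
      nonzero : ¬ (vec ≈ᴹ 0ᴹ)
  open Point public

  pointSetoid : Setoid 0ℓ 0ℓ
  pointSetoid = On.setoid (record { isEquivalence = ∼-isEquivalence }) vec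

  open Setoid pointSetoid public using () renaming (_≈_ to _≈ᴾ_)

  PointSet : Set₁
  PointSet = Pred Point 0ℓ

  -- The line l∞ of PG(2,qⁿ), respectively the hyperplane H∞ of PG(2n,q).
  AtInfinity : PointSet
  AtInfinity P = proj₂ (proj₂ (vec P)) ≈ 0#

  Affine : PointSet
  Affine = ∁ AtInfinity

  IsProjectiveSubspace : ℕ → PointSet → Set₁
  IsProjectiveSubspace d S = ∃ λ (W : Subspace) →
    Subspace.Vectors W ⊆ Subspace.Vectors V ×
    HasDim W (suc d) ×
    S ≐ (λ P → vec P ∈ Subspace.Vectors W)

  -- Π is a d-dimensional affine subspace with projective completion Π̄.
  IsAffineSubspace : ℕ → PointSet → PointSet → Set₁
  IsAffineSubspace d Π Π̄ =
    IsProjectiveSubspace d Π̄ × ¬ (Π̄ ⊆ AtInfinity) × Π ≐ (Π̄ ∩ Affine)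

module Plane (L : Field) where
  open Field L
  open Module (L³ L)
  open LinearAlgebra L (whole L)

  allVectors : Subspace
  allVectors = record
    { Vectors = U ; respᴹ = λ _ _ → tt ; 0ᴹ∈ = tt
    ; +ᴹ-∈ = λ _ _ → tt ; *ₗ-∈ = λ _ _ → tt }

  open Projective L (whole L) allVectors public

  IsSubplane : Subfield L → PointSet → Set
  IsSubplane K B = ∃ λ (e : Fin 3 → Carrierᴹ) →
    Independent e ×
    B ≐ (λ P → ∃ λ s → (∀ i → s i ∈ Subfield.Mem K) × ¬ (∀ i → s i ≈ 0#)
                       × vec P ∼ combination s e)

  -- m is the order of the coordinatising subfield of the subplane B.
  IsSecant : ℕ → PointSet → Set
  IsSecant m B = HasCard pointSetoid (B ∩ AtInfinity) (suc m)

module ABB (L : Field) (F : Subfield L) where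
  open Field L
  open Module (L³ L)
  open LinearAlgebra L F
  private
    module F = Subfield F
    module PG₂ where
      open Plane L public
      open LinearAlgebra L (whole L) public using (_∼_)

  ambient : Subspace
  ambient = record
    { Vectors = λ v → proj₂ (proj₂ v) ∈ F.Mem
    ; respᴹ = λ u≈v → F.resp (proj₂ (proj₂ u≈v))
    ; 0ᴹ∈   = F.0∈
    ; +ᴹ-∈  = F.+-∈
    ; *ₗ-∈  = F.*-∈
    }

  open Projective L F ambient public renaming (AtInfinity to H∞)

  -- The ABB-map φ applied to a set of affine points of PG(2,qⁿ); every affine
  -- point has a representative (a , b , 1).
  φ[_] : PG₂.PointSet → PointSet
  φ[ S ] Q = ∃ λ (P : PG₂.Point) → P ∈ S × ∃₂ λ a b →
    PG₂.vec P PG₂.∼ (a , b , 1#) × vec Q ∼ (a , b , 1#)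

  IsImageOfSecantSubplane : Subfield L → ℕ → PointSet → Set₁
  IsImageOfSecantSubplane K m Π = ∃ λ (B : PG₂.PointSet) →
    PG₂.IsSubplane K B × PG₂.IsSecant m B × Π ≐ φ[ B ∩ PG₂.Affine ]

  -- 𝒟 K is 𝒟ₖ for K the subfield of order qᵏ, and 𝒟 (whole L) is 𝒟ₙ.
  𝒟 : Subfield L → Pred PointSet 0ℓ
  𝒟 K D = ∃₂ λ a b → ¬ (a ≈ 0# × b ≈ 0#) ×
    D ≐ (λ P → ∃ λ x → x ∈ Subfield.Mem K × ¬ (x ≈ 0#) × vec P ∼ (a * x , b * x , 0#))

  -- For k ≥ 1 and m = qᵏ: S is a (2k-1)-dimensional subspace meeting exactly
  -- m + 1 elements of 𝒟ₙ, each in a (k-1)-dimensional subspace.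
  MeetsSpread : ℕ → ℕ → PointSet → Set₁
  MeetsSpread k m S =
    IsProjectiveSubspace (pred (2 ℕ.* k)) S ×
    HasCard (≐-setoid Point 0ℓ) (λ D → D ∈ 𝒟 (whole L) × S ≬ D) (suc m) ×
    (∀ D → D ∈ 𝒟 (whole L) → S ≬ D → IsProjectiveSubspace (pred k) (S ∩ D))

{-# OPTIONS --safe #-}

-- Both sides are compared with explicit affine K-planes
-- { s u + t v + z : s, t ∈ K }, where K is the subfield of order qᵏ, the
-- directions u, v ∈ L² are L-independent, and z ∈ L².
--
-- Two points at infinity of a subplane and any further K-combination of its
-- generators off the line at infinity form another basis of the subplane;
-- scaling the latter vector to (z , 1) puts the affine part in this form.
--
-- Conversely, let W₀ be the space at infinity of Π̄. By counting it is A u ⊕ B v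
-- for two spread elements L u, L v with u, v ∈ W₀, where A = {x : x u ∈ W₀} and
-- B = {x : x v ∈ W₀}. The spread element through u + y v with y ∈ B also meets
-- W₀ in qᵏ vectors x (u + y v), so x y ∈ B for every x ∈ A. Since 1 ∈ A ∩ B, this
-- gives A = B, and A is closed under multiplication. Hence every x ∈ A satisfies
-- x^(qᵏ) = x, and A = K because K already contains all roots of this equation.

module Submission where

open import Defs
open import Level using (Level; 0ℓ; _⊔_)
open import Algebra.Bundles using (CommutativeRing)
open import Algebra.Module.Bundles using (Module)
import Algebra.Properties.CommutativeMonoid.Sum as Sum
import Algebra.Properties.Ring as RingProperties
import Algebra.Properties.Semiring.Exp as Exp
import Algebra.Properties.Semiring.Mult.TCOptimised as SemiringMult
import Algebra.Solver.Ring
open import Algebra.Solver.Ring.AlmostCommutativeRing using (fromCommutativeRing; _-Raw-AlmostCommutative⟶_; Induced-equivalence)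
open import Data.Fin using (Fin; zero; suc; punchIn; punchOut; combine; remQuot; finToFun; funToFin)
import Data.Fin.Properties as Finₚ
open import Data.Fin.Permutation using (permutation)
open import Data.Integer as ℤ using (ℤ; +_; -[1+_])
import Data.Integer.Properties as ℤₚ
open import Data.Maybe using () renaming (map to mapMaybe)
open import Data.Nat using (ℕ; zero; suc; _≤_; s≤s; z≤n)
import Data.Nat as ℕ
import Data.Nat.Properties as ℕₚ
open import Data.Product using (_×_; _,_; ∃; ∃₂; ∃-syntax; proj₁; proj₂; map; <_,_>)
open import Data.Product.Relation.Binary.Pointwise.NonDependent using (×-setoid)
open import Data.Unit using (tt)
open import Function using (_∘_)
open import Function.Bundles using (Bijection; _⇔_; mk⇔)
open import Function.Definitions using (Injective)
open import Relation.Binary.Bundles using (Setoid)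
open import Relation.Binary.Definitions using (Decidable; tri<; tri≈; tri>; WeaklyDecidable; _Respects_)
import Relation.Binary.Reasoning.Setoid
import Relation.Binary.Structures
open import Relation.Binary.PropositionalEquality as ≡ using (_≡_)
open import Relation.Nullary using (Dec; yes; no; contradiction; ¬_)
open import Relation.Nullary.Decidable using (dec⇒maybe; map′; _×-dec_; ¬?; decidable-stable)
open import Relation.Unary using (Pred; _∈_; _⊆_; _≐_; _∩_; _≬_; _⟨×⟩_)
open import Relation.Unary.Relation.Binary.Equality using (≐-setoid)

-- Counting stands in for most of the linear algebra. An injection between finite sets of equal size
-- is onto, and a subspace with q^m vectors over a field of q elements has dimension m, so a space
-- is handled by parametrising it bijectively by copies of K and F; no bases of K over F appear. The
-- obstacle in the converse direction is that A is at first only an additive group: condition (ii)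
-- speaks of F-subspaces and provides no multiplication. The product x y has to come from geometry,
-- namely from the extra spread elements through u + y v: uniqueness of coordinates puts their
-- scalars inside A, and equal size makes them all of A. The identity x^(q^k) = x is proved for any
-- finite set that contains 0 and is closed under multiplication, so it applies to A before A is
-- known to be a field. The F-subspaces of Σ contain K-planes only because F ⊆ K; that inclusion
-- comes from the same root count, since x^q = x gives x^(q^k) = x. Constructively, the enumeration
-- of L decides equality, and each existence claim that would need excluded middle becomes a finite
-- search.

private variable
  a a′ ℓ ℓ′ p p′ : Level

-- Counting in finite setoids.

injective⇒surjective : ∀ {n} (f : Fin n → Fin n) → Injective _≡_ _≡_ f → ∀ j → ∃ λ i → f i ≡ j
injective⇒surjective {suc n} f inj j with Finₚ.any? (λ i → f i Finₚ.≟ j)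
... | yes hit = hit
-- If `j` were missed, punching it out of the codomain would inject `Fin (suc n)` into `Fin n`.
... | no miss = contradiction
  (Finₚ.injective⇒≤ {f = λ i → punchOut (j≢f i)} (inj ∘ Finₚ.punchOut-injective (j≢f _) (j≢f _)))
  ℕₚ.1+n≰n
  where
  j≢f : ∀ i → ¬ (j ≡ f i)
  j≢f i j≡fi = miss (i , ≡.sym j≡fi)

-- `HasCard` is a bijection onto pairs of an element and a membership proof; separating `elt` from
-- `elt∈` leaves plain elements to compute with. By `injective`, an index does not depend on the
-- membership proof that produced it.
record Enumeration (S : Setoid a ℓ) (P : Pred (Setoid.Carrier S) p) (N : ℕ) : Set (a ⊔ ℓ ⊔ p) where
  open Setoid S
  field
    elt       : Fin N → Carrier
    elt∈      : ∀ i → elt i ∈ P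
    injective : ∀ {i j} → elt i ≈ elt j → i ≡ j
    hits      : ∀ {x} → x ∈ P → ∃ λ i → elt i ≈ x

  index : ∀ {x} → x ∈ P → Fin N
  index = proj₁ ∘ hits

  elt-index : ∀ {x} (x∈ : x ∈ P) → elt (index x∈) ≈ x
  elt-index = proj₂ ∘ hits

  index-injective : ∀ {x y} (x∈ : x ∈ P) (y∈ : y ∈ P) → index x∈ ≡ index y∈ → x ≈ y
  index-injective x∈ y∈ eq =
    trans (sym (elt-index x∈)) (≡.subst (λ i → elt i ≈ _) (≡.sym eq) (elt-index y∈))

  -- Source of the case splits on existence. `Q` must respect `≈` because only the listed
  -- representative of an element is tested.
  search : ∀ {Q : Pred Carrier p′} → (∀ x → Dec (Q x)) → Q Respects _≈_ → Dec (∃ λ x → x ∈ P × x ∈ Q)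
  search Q? resp = map′ (λ (i , q) → elt i , elt∈ i , q)
    (λ (x , x∈ , q) → index x∈ , resp (sym (elt-index x∈)) q)
    (Finₚ.any? (Q? ∘ elt))

module _ {S : Setoid a ℓ} {P : Pred (Setoid.Carrier S) p} where
  open Setoid S

  fromHasCard : ∀ {N} → HasCard S P N → Enumeration S P N
  fromHasCard {N} card = record
    { elt       = proj₁ ∘ B.to
    ; elt∈      = proj₂ ∘ B.to
    ; injective = B.injective
    ; hits      = λ {x} x∈ → proj₁ (B.surjective (x , x∈)) , proj₂ (B.surjective (x , x∈)) ≡.refl
    }
    where
    module B = Bijection card

  toHasCard : ∀ {N} → Enumeration S P N → HasCard S P N
  toHasCard E = record
    { to        = < elt , elt∈ >
    ; cong      = λ { ≡.refl → refl }
    ; bijective = injective , λ (x , x∈) → index x∈ , λ { ≡.refl → elt-index x∈ }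
    }
    where open Enumeration E

  -- Equality is read off from indices. Applied to the whole of L, this supplies the decidable
  -- equality that the later modules take as a parameter.
  decidable : ∀ {N} → Enumeration S P N → ∀ {x y} → x ∈ P → y ∈ P → Dec (x ≈ y)
  decidable E {x} {y} x∈ y∈ = map′ (index-injective x∈ y∈)
    (λ x≈y → injective (trans (elt-index x∈) (trans x≈y (sym (elt-index y∈)))))
    (index x∈ Finₚ.≟ index y∈)
    where open Enumeration E

  relabel : ∀ {N M} → N ≡ M → Enumeration S P N → Enumeration S P M
  relabel ≡.refl E = E

module _ {S : Setoid a ℓ} {T : Setoid a′ ℓ′} {P : Pred (Setoid.Carrier S) p} {Q : Pred (Setoid.Carrier T) p}
  where
  private
    module S = Setoid S
    module T = Setoid T

  InjectiveOn : (f : S.Carrier → T.Carrier) → Set _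
  InjectiveOn f = ∀ {x y} → x ∈ P → y ∈ P → f x T.≈ f y → x S.≈ y

  module _ (f : S.Carrier → T.Carrier) (f∈ : ∀ {x} → x ∈ P → f x ∈ Q) (inj : InjectiveOn f) where

    private
      onIndices : ∀ {N M} → Enumeration S P N → Enumeration T Q M → Fin N → Fin M
      onIndices E F i = Enumeration.index F (f∈ (Enumeration.elt∈ E i))

      onIndices-injective : ∀ {N M} (E : Enumeration S P N) (F : Enumeration T Q M) →
        Injective _≡_ _≡_ (onIndices E F)
      onIndices-injective E F eq =
        Enumeration.injective E (inj (Enumeration.elt∈ E _) (Enumeration.elt∈ E _)
          (Enumeration.index-injective F _ _ eq))

    injection⇒≤ : ∀ {N M} → Enumeration S P N → Enumeration T Q M → N ≤ M
    injection⇒≤ E F = Finₚ.injective⇒≤ (onIndices-injective E F)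

    abstract
      -- Passing to indices turns the map into an injective self-map of `Fin N`. It is abstract so
      -- that the search for the preimage is not unfolded.
      injection⇒surjection : ∀ {N} → Enumeration S P N → Enumeration T Q N →
        ∀ {y} → y ∈ Q → ∃ λ x → x ∈ P × f x T.≈ y
      injection⇒surjection E F y∈ =
        let i , eq = injective⇒surjective (onIndices E F) (onIndices-injective E F) (Enumeration.index F y∈)
        in Enumeration.elt E i , Enumeration.elt∈ E i , Enumeration.index-injective F _ _ eq

    image : ∀ {N} → (∀ {x y} → x S.≈ y → f x T.≈ f y) → (∀ {y} → y ∈ Q → ∃ λ x → x ∈ P × f x T.≈ y) →
      Enumeration S P N → Enumeration T Q N
    image cong onto E = record
      { elt       = f ∘ elt
      ; elt∈      = f∈ ∘ elt∈
      ; injective = injective ∘ inj (elt∈ _) (elt∈ _)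
      ; hits      = λ y∈ → let x , x∈ , fx≈y = onto y∈ in
                    index x∈ , T.trans (cong (elt-index x∈)) fx≈y
      }
      where open Enumeration E

  preimage : ∀ {N} (f : S.Carrier → T.Carrier) → (∀ {x y} → x S.≈ y → f x T.≈ f y) →
    (∀ {x y} → f x T.≈ f y → x S.≈ y) → (∀ {x} → x ∈ P → f x ∈ Q) → (∀ {y} → y ∈ Q → ∃ λ x → x ∈ P × f x T.≈ y) →
    Enumeration T Q N → Enumeration S P N
  preimage f cong inj f∈ onto E = record
    { elt       = λ i → proj₁ (onto (elt∈ i))
    ; elt∈      = λ i → proj₁ (proj₂ (onto (elt∈ i)))
    ; injective = λ eq → injective (T.trans (T.sym (proj₂ (proj₂ (onto (elt∈ _)))))
        (T.trans (cong eq) (proj₂ (proj₂ (onto (elt∈ _))))))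
    ; hits      = λ x∈ → index (f∈ x∈) ,
        inj (T.trans (proj₂ (proj₂ (onto (elt∈ _)))) (elt-index (f∈ x∈)))
    }
    where open Enumeration E

module _ {S : Setoid a ℓ} {P : Pred (Setoid.Carrier S) p} where

  distinct : ∀ {N} → 2 ≤ N → Enumeration S P N → ∃₂ λ x y → x ∈ P × y ∈ P × ¬ Setoid._≈_ S x y
  distinct (s≤s (s≤s _)) E = elt zero , elt (suc zero) , elt∈ zero , elt∈ (suc zero) , λ eq → Finₚ.0≢1+n (injective eq)
    where open Enumeration E

  card-unique : ∀ {N M} → Enumeration S P N → Enumeration S P M → N ≡ M
  card-unique E F = ℕₚ.≤-antisym (injection⇒≤ (λ x → x) (λ z → z) (λ _ _ z → z) E F)
                                 (injection⇒≤ (λ x → x) (λ z → z) (λ _ _ z → z) F E)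

module _ {S : Setoid a ℓ} {P Q : Pred (Setoid.Carrier S) p} where
  open Setoid S

  abstract
    -- The inclusion is an injection between sets of one size, hence onto; the preimage of `y` is
    -- only `≈ y`, so `P` has to respect `≈`.
    ⊆-card⇒⊇ : ∀ {N} → Enumeration S P N → Enumeration S Q N → P Respects _≈_ → P ⊆ Q → Q ⊆ P
    ⊆-card⇒⊇ E F resp P⊆Q y∈ =
      let x , x∈ , x≈y = injection⇒surjection (λ x → x) P⊆Q (λ _ _ z → z) E F y∈ in resp x≈y x∈

module _ {S : Setoid a ℓ} {T : Setoid a′ ℓ′} {P : Pred (Setoid.Carrier S) p} {Q : Pred (Setoid.Carrier T) p}
  where

  product : ∀ {N M} → Enumeration S P N → Enumeration T Q M →
    Enumeration (×-setoid S T) (P ⟨×⟩ Q) (N ℕ.* M)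
  product {N} {M} E F = record
    { elt       = map E.elt F.elt ∘ remQuot M
    ; elt∈      = λ i → E.elt∈ _ , F.elt∈ _
    ; injective = λ {i} {j} (eq₁ , eq₂) → ≡.trans (≡.sym (Finₚ.combine-remQuot {N} M i))
        (≡.trans (≡.cong₂ combine (E.injective eq₁) (F.injective eq₂)) (Finₚ.combine-remQuot {N} M j))
    ; hits      = λ (x∈ , y∈) → combine (E.index x∈) (F.index y∈) ,
        ≡.subst (λ ij → E.elt (proj₁ ij) S.≈ _ × F.elt (proj₂ ij) T.≈ _)
          (≡.sym (Finₚ.remQuot-combine (E.index x∈) (F.index y∈))) (E.elt-index x∈ , F.elt-index y∈)
    }
    where
    module E = Enumeration E
    module F = Enumeration F
    module S = Setoid S
    module T = Setoid T

-- Integer coefficients for the ring solver.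

module ℤ-Solver (R : CommutativeRing 0ℓ 0ℓ) where
  open CommutativeRing R
  open SemiringMult semiring using (×-homo-+; ×1-homo-*; 1+×) renaming (_×_ to _×#_)
  open RingProperties ring
  open Relation.Binary.Reasoning.Setoid setoid

  private
    -- To cancel terms the solver must recognise equal coefficients, and equality in `R` need not be
    -- decidable. Integers map to every commutative ring and are compared decidably.
    ⟦_⟧ : ℤ → Carrier
    ⟦ + n ⟧      = n ×# 1#
    ⟦ -[1+ n ] ⟧ = - (suc n ×# 1#)

    ⟦-⟧ : ∀ i → ⟦ ℤ.- i ⟧ ≈ - ⟦ i ⟧
    ⟦-⟧ (+ zero)  = sym -0#≈0#
    ⟦-⟧ (+ suc n) = refl
    ⟦-⟧ -[1+ n ]  = sym (-‿involutive _)

    x≈[y+x]-y : ∀ x y → x ≈ (y + x) - y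
    x≈[y+x]-y x y = begin
      x            ≈⟨ +-identityʳ x ⟨
      x + 0#       ≈⟨ +-congˡ (-‿inverseʳ y) ⟨
      x + (y - y)  ≈⟨ +-assoc x y (- y) ⟨
      (x + y) - y  ≈⟨ +-congʳ (+-comm x y) ⟩
      (y + x) - y  ∎

    ⟦⊖⟧ : ∀ m n → ⟦ m ℤ.⊖ n ⟧ ≈ m ×# 1# - n ×# 1#
    ⟦⊖⟧ zero    zero    = trans (sym (-‿inverseʳ 0#)) refl
    ⟦⊖⟧ zero    (suc n) = sym (+-identityˡ _)
    ⟦⊖⟧ (suc m) zero    = sym (trans (+-congˡ -0#≈0#) (+-identityʳ _))
    ⟦⊖⟧ (suc m) (suc n) = begin
      ⟦ suc m ℤ.⊖ suc n ⟧                  ≡⟨ ≡.cong ⟦_⟧ (ℤₚ.[1+m]⊖[1+n]≡m⊖n m n) ⟩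
      ⟦ m ℤ.⊖ n ⟧                          ≈⟨ ⟦⊖⟧ m n ⟩
      -- One is added and subtracted, so that both multiples turn into those of the successors.
      m ×# 1# - n ×# 1#                      ≈⟨ +-congʳ (x≈[y+x]-y _ 1#) ⟩
      ((1# + m ×# 1#) - 1#) - n ×# 1#        ≈⟨ +-assoc _ _ _ ⟩
      (1# + m ×# 1#) + (- 1# - n ×# 1#)      ≈⟨ +-congˡ (-‿+-comm 1# (n ×# 1#)) ⟩
      (1# + m ×# 1#) - (1# + n ×# 1#)        ≈⟨ +-cong (1+× m 1#) (-‿cong (1+× n 1#)) ⟨
      suc m ×# 1# - suc n ×# 1#              ∎

    ⟦+⟧ : ∀ i j → ⟦ i ℤ.+ j ⟧ ≈ ⟦ i ⟧ + ⟦ j ⟧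
    ⟦+⟧ (+ m)    (+ n)    = ×-homo-+ 1# m n
    ⟦+⟧ (+ m)    -[1+ n ] = ⟦⊖⟧ m (suc n)
    ⟦+⟧ -[1+ m ] (+ n)    = trans (⟦⊖⟧ n (suc m)) (+-comm _ _)
    ⟦+⟧ -[1+ m ] -[1+ n ] = begin
      - (suc (suc (m ℕ.+ n)) ×# 1#)       ≡⟨ ≡.cong (λ l → - (l ×# 1#)) (≡.sym (ℕₚ.+-suc (suc m) n)) ⟩
      - ((suc m ℕ.+ suc n) ×# 1#)         ≈⟨ -‿cong (×-homo-+ 1# (suc m) (suc n)) ⟩
      - (suc m ×# 1# + suc n ×# 1#)        ≈⟨ -‿+-comm _ _ ⟨
      - (suc m ×# 1#) + - (suc n ×# 1#)    ∎

    ⟦*⟧⁺ : ∀ m j → ⟦ + m ℤ.* j ⟧ ≈ ⟦ + m ⟧ * ⟦ j ⟧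
    ⟦*⟧⁺ m (+ n)    = trans (reflexive (≡.cong ⟦_⟧ (≡.sym (ℤₚ.pos-* m n)))) (×1-homo-* m n)
    ⟦*⟧⁺ m -[1+ n ] = begin
      ⟦ + m ℤ.* -[1+ n ] ⟧               ≡⟨ ≡.cong ⟦_⟧ (ℤₚ.neg-distribʳ-* (+ m) (+ suc n)) ⟨
      ⟦ ℤ.- (+ m ℤ.* + suc n) ⟧          ≈⟨ ⟦-⟧ (+ m ℤ.* + suc n) ⟩
      - ⟦ + m ℤ.* + suc n ⟧              ≈⟨ -‿cong (⟦*⟧⁺ m (+ suc n)) ⟩
      - (⟦ + m ⟧ * ⟦ + suc n ⟧)          ≈⟨ -‿distribʳ-* _ _ ⟩
      ⟦ + m ⟧ * - ⟦ + suc n ⟧            ∎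

    ⟦*⟧ : ∀ i j → ⟦ i ℤ.* j ⟧ ≈ ⟦ i ⟧ * ⟦ j ⟧
    ⟦*⟧ (+ m)    j = ⟦*⟧⁺ m j
    ⟦*⟧ -[1+ m ] j = begin
      ⟦ -[1+ m ] ℤ.* j ⟧                 ≡⟨ ≡.cong ⟦_⟧ (ℤₚ.neg-distribˡ-* (+ suc m) j) ⟨
      ⟦ ℤ.- (+ suc m ℤ.* j) ⟧            ≈⟨ ⟦-⟧ (+ suc m ℤ.* j) ⟩
      - ⟦ + suc m ℤ.* j ⟧                ≈⟨ -‿cong (⟦*⟧⁺ (suc m) j) ⟩
      - (⟦ + suc m ⟧ * ⟦ j ⟧)            ≈⟨ -‿distribˡ-* _ _ ⟩
      - ⟦ + suc m ⟧ * ⟦ j ⟧              ∎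

    ℤ⟶R : ℤ.+-*-rawRing -Raw-AlmostCommutative⟶ fromCommutativeRing R
    ℤ⟶R = record
      { ⟦_⟧ = ⟦_⟧ ; +-homo = ⟦+⟧ ; *-homo = ⟦*⟧ ; -‿homo = ⟦-⟧ ; 0-homo = refl ; 1-homo = refl }

    equal? : WeaklyDecidable (Induced-equivalence ℤ⟶R)
    equal? i j = mapMaybe (λ i≡j → reflexive (≡.cong ⟦_⟧ i≡j)) (dec⇒maybe (i ℤ.≟ j))

  open Algebra.Solver.Ring ℤ.+-*-rawRing (fromCommutativeRing R) ℤ⟶R equal? public
    using (solve; _:=_; _:+_; _:*_; _:-_; :-_; con)

module _ {a ℓ p} {S : Setoid a ℓ} {P : Pred (Setoid.Carrier S) p} where
  open Setoid S

  removeElement : ∀ {M z} → Enumeration S P (suc M) → z ∈ P → Enumeration S (λ x → x ∈ P × ¬ x ≈ z) M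
  removeElement {z = z} E z∈ = record
    { elt       = λ j → elt (punchIn i₀ j)
    ; elt∈      = λ j → elt∈ _ , λ eq → Finₚ.punchInᵢ≢i i₀ j (injective (trans eq (sym (elt-index z∈))))
    ; injective = λ eq → Finₚ.punchIn-injective i₀ _ _ (injective eq)
    ; hits      = λ (x∈ , x≉z) →
        let i₀≢ = λ eq → x≉z (sym (index-injective z∈ x∈ eq)) in
        punchOut i₀≢ , trans (reflexive (≡.cong elt (Finₚ.punchIn-punchOut i₀≢))) (elt-index x∈)
    }
    where
    open Enumeration E
    i₀ = index z∈

-- Finite fields: the identity x^N = x, roots of polynomials, inclusion of subfields.

module FieldProperties (L : Field) where
  open Field L hiding (zero)
  open ℤ-Solver commutativeRing public
  open RingProperties ring public
  open Exp semiring public using (_^_; ^-congˡ; ^-assocʳ)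
  open Relation.Binary.Reasoning.Setoid setoid

  x*y≈0⇒y≈0 : ∀ {x y} → ¬ x ≈ 0# → x * y ≈ 0# → y ≈ 0#
  x*y≈0⇒y≈0 {x} {y} x≉0 xy≈0 = let x⁻¹ , xx⁻¹≈1 = inverse x x≉0 in begin
    y               ≈⟨ *-identityˡ y ⟨
    1# * y          ≈⟨ *-congʳ xx⁻¹≈1 ⟨
    x * x⁻¹ * y     ≈⟨ solve 3 (λ x x⁻¹ y → x :* x⁻¹ :* y := x⁻¹ :* (x :* y)) refl x x⁻¹ y ⟩
    x⁻¹ * (x * y)   ≈⟨ *-congˡ xy≈0 ⟩
    x⁻¹ * 0#        ≈⟨ zeroʳ x⁻¹ ⟩
    0#              ∎

  *-≉0 : ∀ {x y} → ¬ x ≈ 0# → ¬ y ≈ 0# → ¬ x * y ≈ 0#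
  *-≉0 x≉0 y≉0 xy≈0 = y≉0 (x*y≈0⇒y≈0 x≉0 xy≈0)

  xy≈1⇒y≉0 : ∀ {x y} → x * y ≈ 1# → ¬ y ≈ 0#
  xy≈1⇒y≉0 {x} xy≈1 y≈0 = 1≉0 (trans (sym xy≈1) (trans (*-congˡ y≈0) (zeroʳ x)))

  x-y≈0⇒x≈y : ∀ {x y} → x - y ≈ 0# → x ≈ y
  x-y≈0⇒x≈y = x∙y⁻¹≈ε⇒x≈y _ _

  x≈y⇒x-y≈0 : ∀ {x y} → x ≈ y → x - y ≈ 0#
  x≈y⇒x-y≈0 = x≈y⇒x∙y⁻¹≈ε

  *-cancelˡ : ∀ {x y z} → ¬ x ≈ 0# → x * y ≈ x * z → y ≈ z
  *-cancelˡ {x} {y} {z} x≉0 eq = x-y≈0⇒x≈y (x*y≈0⇒y≈0 x≉0 (trans (x[y-z]≈xy-xz x y z) (x≈y⇒x-y≈0 eq)))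

  private
    module ∏ = Sum *-commutativeMonoid

  ∏-≉0 : ∀ {m} (f : Fin m → Carrier) → (∀ i → ¬ f i ≈ 0#) → ¬ ∏.sum f ≈ 0#
  ∏-≉0 {zero}  f f≉0 = 1≉0
  ∏-≉0 {suc m} f f≉0 = *-≉0 (f≉0 zero) (∏-≉0 (f ∘ suc) (f≉0 ∘ suc))

  -- Stated for a set closed under multiplication, since it serves both for subfields and for the
  -- set of scalars A, whose field structure is still to be established.
  module _ {p} {P : Pred Carrier p} (*-∈ : ∀ {x y} → x ∈ P → y ∈ P → x * y ∈ P) (0∈ : 0# ∈ P) where

    abstract
      -- Multiplication by x permutes the nonzero elements of P, so it does not
      -- change their product.
      x^N≈x : ∀ {N} → Enumeration setoid P N → ∀ {x} → x ∈ P → x ^ N ≈ x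
      x^N≈x {zero}  E = contradiction (Enumeration.index E 0∈) λ ()
      x^N≈x {suc M} E {x} x∈ with decidable E x∈ 0∈
      ... | yes x≈0 = trans (*-congʳ x≈0) (trans (zeroˡ _) (sym x≈0))
      ... | no  x≉0 = trans (*-congˡ x^M≈1) (*-identityʳ x)
        where
        E* : Enumeration setoid (λ y → y ∈ P × ¬ y ≈ 0#) M
        E* = removeElement {S = setoid} {P = P} E 0∈
        open Enumeration E*

        xe∈ : ∀ i → x * elt i ∈ P × ¬ x * elt i ≈ 0#
        xe∈ i = let e∈ , e≉0 = elt∈ i in *-∈ x∈ e∈ , *-≉0 x≉0 e≉0

        σ : Fin M → Fin M
        σ i = index (xe∈ i)

        σ-injective : Injective _≡_ _≡_ σ
        σ-injective eq = injective (*-cancelˡ x≉0 (index-injective (xe∈ _) (xe∈ _) eq))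

        σ⁻¹ : Fin M → Fin M
        σ⁻¹ j = proj₁ (injective⇒surjective σ σ-injective j)

        σσ⁻¹ : ∀ j → σ (σ⁻¹ j) ≡ j
        σσ⁻¹ j = proj₂ (injective⇒surjective σ σ-injective j)

        x^M≈1 : x ^ M ≈ 1#
        x^M≈1 = sym (*-cancelˡ (∏-≉0 elt (proj₂ ∘ elt∈)) (begin
          ∏.sum elt * 1#                        ≈⟨ *-identityʳ _ ⟩
          ∏.sum elt                             ≈⟨ ∏.sum-permute elt (permutation σ σ⁻¹ σσ⁻¹ λ i → σ-injective (σσ⁻¹ (σ i))) ⟩
          ∏.sum (elt ∘ σ)                       ≈⟨ ∏.sum-cong-≋ (λ i → elt-index (xe∈ i)) ⟩
          ∏.sum (λ i → x * elt i)               ≈⟨ ∏.∑-distrib-+ (λ _ → x) elt ⟩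
          ∏.sum {M} (λ _ → x) * ∏.sum elt       ≈⟨ *-comm _ _ ⟩
          ∏.sum elt * ∏.sum {M} (λ _ → x)       ≈⟨ *-congˡ (∏.sum-replicate M) ⟩
          ∏.sum elt * x ^ M                     ∎))

  -- Raising to the power q^k is the q-th power map iterated k times, and `x` is a fixed point of
  -- that map.
  x^q≈x⇒x^q^k≈x : ∀ {q x} → x ^ q ≈ x → ∀ k → x ^ (q ℕ.^ k) ≈ x
  x^q≈x⇒x^q^k≈x {q} {x} x^q≈x zero    = *-identityʳ x
  x^q≈x⇒x^q^k≈x {q} {x} x^q≈x (suc k) = begin
    x ^ (q ℕ.* q ℕ.^ k)   ≈⟨ ^-assocʳ x q (q ℕ.^ k) ⟨
    (x ^ q) ^ (q ℕ.^ k)   ≈⟨ ^-congˡ (q ℕ.^ k) x^q≈x ⟩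
    x ^ (q ℕ.^ k)         ≈⟨ x^q≈x⇒x^q^k≈x x^q≈x k ⟩
    x                     ∎

  -- A polynomial is given by its value function with a Horner scheme, `horner c` standing for x
  -- g(x) + c. The index is the degree, and the base case makes the leading coefficient 1.
  data Monic : ℕ → (Carrier → Carrier) → Set where
    one    : ∀ {f} → (∀ x → f x ≈ 1#) → Monic 0 f
    horner : ∀ {d f g} c → Monic d g → (∀ x → f x ≈ x * g x + c) → Monic (suc d) f

  -- Synthetic division: from g(x) = (x - a) h(x) + g(a), the quotient of x g(x) + c is x h(x) +
  -- g(a), which is again in Horner form.
  factor : ∀ {d f} → Monic (suc d) f → ∀ a → ∃[ g ] Monic d g × (∀ x → f x ≈ (x - a) * g x + f a)
  factor {f = f} (horner {g = g} c (one g≈1) f≈) a = g , one g≈1 , λ x → begin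
    f x                          ≈⟨ f≈ x ⟩
    x * g x + c                  ≈⟨ +-congʳ (*-congˡ (g≈1 x)) ⟩
    x * 1# + c                   ≈⟨ solve 3 (λ x a c → x :* con (+ 1) :+ c := (x :- a) :* con (+ 1) :+ (a :* con (+ 1) :+ c)) refl x a c ⟩
    (x - a) * 1# + (a * 1# + c)  ≈⟨ +-cong (*-congˡ (g≈1 x)) (+-congʳ (*-congˡ (g≈1 a))) ⟨
    (x - a) * g x + (a * g a + c) ≈⟨ +-congˡ (f≈ a) ⟨
    (x - a) * g x + f a          ∎
  factor {f = f} (horner {g = g} c g-monic@(horner _ _ _) f≈) a =
    let h , h-monic , g≈ = factor g-monic a in
    (λ x → x * h x + g a) , horner (g a) h-monic (λ _ → refl) , λ x → begin
    f x                                         ≈⟨ f≈ x ⟩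
    x * g x + c                                 ≈⟨ +-congʳ (*-congˡ (g≈ x)) ⟩
    x * ((x - a) * h x + g a) + c
      ≈⟨ solve 5 (λ x a h g c → x :* ((x :- a) :* h :+ g) :+ c := (x :- a) :* (x :* h :+ g) :+ (a :* g :+ c)) refl x a (h x) (g a) c ⟩
    (x - a) * (x * h x + g a) + (a * g a + c)   ≈⟨ +-congˡ (f≈ a) ⟨
    (x - a) * (x * h x + g a) + f a             ∎

  -- Dividing out the first root leaves a polynomial of smaller degree; the other roots differ from
  -- the first, so in a field they are roots of the quotient.
  roots≤degree : ∀ {d f} → Monic d f → (r : Fin (suc d) → Carrier) → Injective _≡_ _≈_ r →
    ¬ (∀ i → f (r i) ≈ 0#)
  roots≤degree (one f≈1) r inj root = 1≉0 (trans (sym (f≈1 _)) (root zero))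
  roots≤degree {f = f} f-monic@(horner _ _ _) r inj root =
    let g , g-monic , f≈ = factor f-monic (r zero) in
    roots≤degree g-monic (r ∘ suc) (Finₚ.suc-injective ∘ inj) λ i →
      x*y≈0⇒y≈0 (λ eq → Finₚ.0≢1+n (inj (sym (x-y≈0⇒x≈y eq))))
        (begin
          (r (suc i) - r zero) * g (r (suc i))             ≈⟨ +-identityʳ _ ⟨
          (r (suc i) - r zero) * g (r (suc i)) + 0#        ≈⟨ +-congˡ (root zero) ⟨
          (r (suc i) - r zero) * g (r (suc i)) + f (r zero) ≈⟨ f≈ _ ⟨
          f (r (suc i))                                    ≈⟨ root (suc i) ⟩
          0#                                               ∎)

  X^-monic : ∀ n → Monic n (_^ n)
  X^-monic zero    = one λ _ → refl
  X^-monic (suc n) = horner 0# (X^-monic n) λ _ → sym (+-identityʳ _)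

  -- The bound matters: X - X vanishes identically, and 1 - X is not monic of degree 0.
  X^n-X-monic : ∀ {n} → 2 ≤ n → Monic n (λ x → x ^ n - x)
  X^n-X-monic (s≤s (s≤s {n = n} z≤n)) = horner 0# (horner (- 1#) (X^-monic n) λ _ → refl) λ x →
    solve 2 (λ x y → x :* (x :* y) :- x := x :* (x :* y :+ :- con (+ 1)) :+ con (+ 0)) refl x (x ^ n)

  2≤order : ∀ {N} (K : Subfield L) → Enumeration setoid (Subfield.Mem K) N → 2 ≤ N
  2≤order {N} K E = Finₚ.injective⇒≤ {f = f} f-injective
    where
    open Enumeration E
    open Subfield K
    f : Fin 2 → Fin N
    f zero       = index 0∈
    f (suc zero) = index 1∈

    f-injective : Injective _≡_ _≡_ f
    f-injective {zero}     {zero}     eq = ≡.refl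
    f-injective {zero}     {suc zero} eq = contradiction (sym (index-injective 0∈ 1∈ eq)) 1≉0
    f-injective {suc zero} {zero}     eq = contradiction (index-injective 1∈ 0∈ eq) 1≉0
    f-injective {suc zero} {suc zero} eq = ≡.refl

  module _ (_≟_ : Decidable _≈_) where

    abstract
      -- The N elements of K already exhaust the roots of X^N − X.
      x^N≈x⇒x∈ : ∀ {N} (K : Subfield L) → Enumeration setoid (Subfield.Mem K) N → ∀ {x} → x ^ N ≈ x →
        x ∈ Subfield.Mem K
      x^N≈x⇒x∈ {N} K E {x} x^N≈x′ with Enumeration.search E (x ≟_) (λ y≈z x≈y → trans x≈y y≈z)
      ... | yes (y , y∈ , x≈y) = Subfield.resp K (sym x≈y) y∈
      ... | no  x∉ = contradiction root (roots≤degree (X^n-X-monic (2≤order K E)) r r-injective)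
        where
        open Enumeration E
        r : Fin (suc N) → Carrier
        r zero    = x
        r (suc i) = elt i

        r-injective : Injective _≡_ _≈_ r
        r-injective {zero}  {zero}  eq = ≡.refl
        r-injective {zero}  {suc j} eq = contradiction (_ , elt∈ j , eq) x∉
        r-injective {suc i} {zero}  eq = contradiction (_ , elt∈ i , sym eq) x∉
        r-injective {suc i} {suc j} eq = ≡.cong suc (injective eq)

        root : ∀ i → r i ^ N - r i ≈ 0#
        root zero    = x≈y⇒x-y≈0 x^N≈x′
        root (suc i) = x≈y⇒x-y≈0 (x^N≈x (Subfield.*-∈ K) (Subfield.0∈ K) E (elt∈ i))

    -- An element of `F` satisfies x^q = x, hence x^(q^k) = x, and `K` contains every root of the
    -- latter equation in L.
    subfield-⊆ : ∀ {q} k (F K : Subfield L) → Enumeration setoid (Subfield.Mem F) q →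
      Enumeration setoid (Subfield.Mem K) (q ℕ.^ k) → Subfield.Mem F ⊆ Subfield.Mem K
    subfield-⊆ k F K EF EK x∈ = x^N≈x⇒x∈ K EK
      (x^q≈x⇒x^q^k≈x (x^N≈x {P = Subfield.Mem F} (Subfield.*-∈ F) (Subfield.0∈ F) EF x∈) k)

-- Dimension of subspaces by counting vectors.

funToFin-cong : ∀ {m n} {f g : Fin m → Fin n} → (∀ i → f i ≡ g i) → funToFin f ≡ funToFin g
funToFin-cong {zero}  f≗g = ≡.refl
funToFin-cong {suc m} f≗g = ≡.cong₂ combine (f≗g zero) (funToFin-cong (f≗g ∘ suc))

^-injectiveʳ : ∀ {q} → 2 ≤ q → ∀ m n → q ℕ.^ m ≡ q ℕ.^ n → m ≡ n
^-injectiveʳ {q} 2≤q m n eq with ℕₚ.<-cmp m n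
... | tri< m<n _ _ = contradiction eq (ℕₚ.<⇒≢ (ℕₚ.^-monoʳ-< q 2≤q m<n))
... | tri≈ _ m≡n _ = m≡n
... | tri> _ _ n<m = contradiction (≡.sym eq) (ℕₚ.<⇒≢ (ℕₚ.^-monoʳ-< q 2≤q n<m))

module Dimension (L : Field) (K : Subfield L) (_≟_ : Decidable (Field._≈_ L)) {q : ℕ}
  (E : Enumeration (Field.setoid L) (Subfield.Mem K) q) where
  open Field L hiding (zero)
  open FieldProperties L
  open Module (L³ L)
  open LinearAlgebra L K
  private
    module E = Enumeration E
    module K = Subfield K

  _≟ᴹ_ : Decidable _≈ᴹ_
  (a , b , c) ≟ᴹ (a′ , b′ , c′) = (a ≟ a′) ×-dec (b ≟ b′) ×-dec (c ≟ c′)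

  combination-cong : ∀ {m} {s t : Fin m → Carrier} (e : Fin m → Carrierᴹ) → (∀ i → s i ≈ t i) →
    combination s e ≈ᴹ combination t e
  combination-cong e s≈t = Sum.sum-cong-≋ +ᴹ-commutativeMonoid λ i → *ₗ-cong (s≈t i) ≈ᴹ-refl

  -- One identity for several uses: r = -1 gives differences, and s = 0 gives multiples.
  combination-linear : ∀ {m} r (s t : Fin m → Carrier) (e : Fin m → Carrierᴹ) →
    combination (λ i → s i + r * t i) e ≈ᴹ combination s e +ᴹ r *ₗ combination t e
  combination-linear {zero}  r s t e = z , z , z
    where z = solve 1 (λ r → con (+ 0) := con (+ 0) :+ r :* con (+ 0)) refl r
  combination-linear {suc m} r s t e =
    let x , y , z = combination-linear r (s ∘ suc) (t ∘ suc) (e ∘ suc) in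
    step x , step y , step z
    where
    step : ∀ {a b c d} → a ≈ b + r * c → (s zero + r * t zero) * d + a ≈ (s zero * d + b) + r * (t zero * d + c)
    step {_} {b} {c} {d} a≈ = trans (+-congˡ a≈)
      (solve 6 (λ r s t b c d → (s :+ r :* t) :* d :+ (b :+ r :* c) := (s :* d :+ b) :+ r :* (t :* d :+ c))
        refl r (s zero) (t zero) b c d)

  combination-zero : ∀ {m} (e : Fin m → Carrierᴹ) → combination (λ _ → 0#) e ≈ᴹ 0ᴹ
  combination-zero {zero}  e = ≈ᴹ-refl
  combination-zero {suc m} e =
    ≈ᴹ-trans (+ᴹ-cong (*ₗ-zeroˡ (e zero)) (combination-zero (e ∘ suc))) (+ᴹ-identityˡ 0ᴹ)

  combination∈ : ∀ {m} (W : Subspace) {s : Fin m → Carrier} {e : Fin m → Carrierᴹ} →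
    (∀ i → s i ∈ K.Mem) → (∀ i → e i ∈ Subspace.Vectors W) → combination s e ∈ Subspace.Vectors W
  combination∈ {zero}  W s∈ e∈ = Subspace.0ᴹ∈ W
  combination∈ {suc m} W s∈ e∈ =
    Subspace.+ᴹ-∈ W (Subspace.*ₗ-∈ W (s∈ zero) (e∈ zero)) (combination∈ W (s∈ ∘ suc) (e∈ ∘ suc))

  independent⇒injective : ∀ {m} {e : Fin m → Carrierᴹ} {s t : Fin m → Carrier} → Independent e →
    (∀ i → s i ∈ K.Mem) → (∀ i → t i ∈ K.Mem) → combination s e ≈ᴹ combination t e → ∀ i → s i ≈ t i
  independent⇒injective {e = e} {s} {t} indep s∈ t∈ (eq₁ , eq₂ , eq₃) i = x-y≈0⇒x≈y (begin
    s i - t i            ≈⟨ solve 2 (λ x y → x :- y := x :+ :- con (+ 1) :* y) refl (s i) (t i) ⟩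
    s i + - 1# * t i     ≈⟨ indep (λ i → s i + - 1# * t i) (λ i → K.+-∈ (s∈ i) (K.*-∈ (K.neg-∈ K.1∈) (t∈ i)))
                              (≈ᴹ-trans (combination-linear (- 1#) s t e) (cancel eq₁ , cancel eq₂ , cancel eq₃)) i ⟩
    0#                   ∎)
    where
    open Relation.Binary.Reasoning.Setoid setoid
    cancel : ∀ {x y} → x ≈ y → x + - 1# * y ≈ 0#
    cancel {x} {y} eq = trans (+-congʳ eq) (solve 1 (λ y → y :+ :- con (+ 1) :* y := con (+ 0)) refl y)

  Span : ∀ {m} → (Fin m → Carrierᴹ) → Pred Carrierᴹ 0ℓ
  Span e v = ∃ λ s → (∀ i → s i ∈ K.Mem) × v ≈ᴹ combination s e

  private
    coefficients : ∀ {m} → Fin (q ℕ.^ m) → Fin m → Carrier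
    coefficients j = E.elt ∘ finToFun j

    encode : ∀ {m} (s : Fin m → Carrier) → (∀ i → s i ∈ K.Mem) → Fin (q ℕ.^ m)
    encode s s∈ = funToFin (E.index ∘ s∈)

    coefficients-encode : ∀ {m} (s : Fin m → Carrier) (s∈ : ∀ i → s i ∈ K.Mem) i →
      coefficients (encode s s∈) i ≈ s i
    coefficients-encode s s∈ i =
      trans (reflexive (≡.cong E.elt (Finₚ.finToFun-funToFin (E.index ∘ s∈) i))) (E.elt-index (s∈ i))

    coefficients-injective : ∀ m (j j′ : Fin (q ℕ.^ m)) → (∀ i → coefficients {m} j i ≈ coefficients {m} j′ i) → j ≡ j′
    coefficients-injective m j j′ eq = ≡.trans (≡.sym (Finₚ.funToFin-finToFin {m} {q} j))
      (≡.trans (funToFin-cong {m} (E.injective ∘ eq)) (Finₚ.funToFin-finToFin {m} {q} j′))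

  -- Up to `≈` there are only q^m coefficient families, so all of them can be tried.
  span? : ∀ {m} (e : Fin m → Carrierᴹ) v → Dec (v ∈ Span e)
  span? e v = map′ (λ (j , eq) → coefficients j , (λ i → E.elt∈ _) , eq)
    (λ (s , s∈ , eq) → encode s s∈ ,
      ≈ᴹ-trans eq (≈ᴹ-sym (combination-cong e (coefficients-encode s s∈))))
    (Finₚ.any? λ j → v ≟ᴹ combination (coefficients j) e)

  module _ {W : Subspace} where
    open Subspace W

    dim⇒card : ∀ {m} → HasDim W m → Enumeration ≈ᴹ-setoid Vectors (q ℕ.^ m)
    dim⇒card {m} (e , e∈ , indep , spans) = record
      { elt       = λ j → combination (coefficients {m} j) e
      ; elt∈      = λ j → combination∈ W (λ i → E.elt∈ _) e∈
      ; injective = λ {j} {j′} eq → coefficients-injective m j j′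
          (independent⇒injective {e = e} {coefficients j} {coefficients j′} indep (λ i → E.elt∈ _) (λ i → E.elt∈ _) eq)
      ; hits      = λ v∈ → let s , s∈ , eq = spans _ v∈ in encode s s∈ ,
          ≈ᴹ-trans (combination-cong e (coefficients-encode s s∈)) (≈ᴹ-sym eq)
      }

    private
      -- Greedy choice along the list, from its end: an entry is added exactly when it is outside
      -- the span of those already chosen.
      basis : ∀ N (w : Fin N → Carrierᴹ) → (∀ i → w i ∈ Vectors) →
        ∃ λ m → ∃ λ (e : Fin m → Carrierᴹ) → (∀ i → e i ∈ Vectors) × Independent e × (∀ i → w i ∈ Span e)
      basis zero    w w∈ = 0 , (λ ()) , (λ ()) , (λ _ _ _ ()) , (λ ())
      basis (suc N) w w∈ with basis N (w ∘ suc) (w∈ ∘ suc)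
      ... | m , e , e∈ , indep , spans with span? e (w zero)
      ... | yes w₀∈ = m , e , e∈ , indep , λ { zero → w₀∈ ; (suc i) → spans i }
      ... | no  w₀∉ = suc m , e⁺ , (λ { zero → w∈ zero ; (suc i) → e∈ i }) , indep⁺ ,
        λ { zero    → (λ { zero → 1# ; (suc _) → 0# }) , (λ { zero → K.1∈ ; (suc _) → K.0∈ }) , head∈
          ; (suc i) → let s , s∈ , eq = spans i in
              (λ { zero → 0# ; (suc j) → s j }) , (λ { zero → K.0∈ ; (suc j) → s∈ j }) ,
              ≈ᴹ-trans eq (≈ᴹ-sym (drop0 s)) }
        where
        e⁺ : Fin (suc m) → Carrierᴹ
        e⁺ zero    = w zero
        e⁺ (suc i) = e i

        head∈ : w zero ≈ᴹ 1# *ₗ w zero +ᴹ combination (λ _ → 0#) e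
        head∈ = ≈ᴹ-sym (≈ᴹ-trans (+ᴹ-cong (*ₗ-identityˡ _) (combination-zero e)) (+ᴹ-identityʳ _))

        drop0 : ∀ s → 0# *ₗ w zero +ᴹ combination s e ≈ᴹ combination s e
        drop0 s = ≈ᴹ-trans (+ᴹ-cong (*ₗ-zeroˡ _) ≈ᴹ-refl) (+ᴹ-identityˡ _)

        isolate : ∀ {s₀ r a b} → s₀ * r ≈ 1# → s₀ * a + b ≈ 0# → a ≈ 0# + - r * b
        isolate {s₀} {r} {a} {b} sr≈1 eq = trans (sym (*-identityˡ a)) (trans (*-congʳ (sym sr≈1))
          (trans (solve 4 (λ s₀ r a b → s₀ :* r :* a := r :* (s₀ :* a :+ b) :+ (con (+ 0) :+ :- r :* b)) refl s₀ r a b)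
            (trans (+-congʳ (trans (*-congˡ eq) (zeroʳ r))) (+-identityˡ _))))

        s₀≈0 : ∀ s → (∀ i → s i ∈ K.Mem) → combination s e⁺ ≈ᴹ 0ᴹ → s zero ≈ 0#
        s₀≈0 s s∈ (eq₁ , eq₂ , eq₃) with s zero ≟ 0#
        ... | yes s₀≈0 = s₀≈0
        ... | no  s₀≉0 =
          -- An invertible coefficient of `w zero` would put `w zero` into the span of `e`. The
          -- leading `0# +` gives the new coefficients the shape of `combination-linear`.
          let r , sr≈1 = inverse (s zero) s₀≉0 in
          contradiction
            ( (λ i → 0# + - r * s (suc i))
            , (λ i → K.+-∈ K.0∈ (K.*-∈ (K.neg-∈ (K.inv-∈ (s∈ zero) sr≈1)) (s∈ (suc i))))
            , ≈ᴹ-trans (isolate sr≈1 eq₁ , isolate sr≈1 eq₂ , isolate sr≈1 eq₃)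
                (≈ᴹ-sym (≈ᴹ-trans (combination-linear (- r) (λ _ → 0#) (s ∘ suc) e)
                  (+ᴹ-cong (combination-zero e) ≈ᴹ-refl))) )
            w₀∉

        indep⁺ : Independent e⁺
        indep⁺ s s∈ eq zero    = s₀≈0 s s∈ eq
        indep⁺ s s∈ eq (suc i) = indep (s ∘ suc) (s∈ ∘ suc)
          (≈ᴹ-trans (≈ᴹ-sym (drop0 (s ∘ suc)))
            (≈ᴹ-trans (+ᴹ-cong (*ₗ-cong (sym (s₀≈0 s s∈ eq)) ≈ᴹ-refl) ≈ᴹ-refl) eq)) i

    abstract
      -- The greedy basis of the list of all vectors has some length m′. Counting gives q^m′ = q^m,
      -- and q ≥ 2 then forces m′ = m.
      card⇒dim : ∀ {m} → Enumeration ≈ᴹ-setoid Vectors (q ℕ.^ m) → HasDim W m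
      card⇒dim {m} V with basis _ (Enumeration.elt V) (Enumeration.elt∈ V)
      ... | m′ , e , e∈ , indep , spans = ≡.subst (HasDim W)
          (^-injectiveʳ (2≤order K E) m′ m (card-unique (dim⇒card hasDim) V)) hasDim
        where
        hasDim : HasDim W m′
        hasDim = e , e∈ , indep , λ v v∈ →
          let s , s∈ , eq = spans (Enumeration.index V v∈) in
          s , s∈ , ≈ᴹ-trans (≈ᴹ-sym (Enumeration.elt-index V v∈)) eq

-- Determinants, points of a projective line, and frames of affine planes.

module Directions (L : Field) (_≟_ : Decidable (Field._≈_ L)) where
  open Field L hiding (zero)
  open FieldProperties L
  open Relation.Binary.Reasoning.Setoid setoid

  det : Carrier → Carrier → Carrier → Carrier → Carrier
  det a b c d = a * d - b * c

  abstract
    -- Cramer's rule: the determinant times either coordinate is a combination of the two sums, and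
    -- the determinant can be cancelled.
    det≉0⇒injective : ∀ {a b c d s t s′ t′} → ¬ det a b c d ≈ 0# →
      s * a + t * c ≈ s′ * a + t′ * c → s * b + t * d ≈ s′ * b + t′ * d → s ≈ s′ × t ≈ t′
    det≉0⇒injective {a} {b} {c} {d} {s} {t} {s′} {t′} det≉0 eq₁ eq₂ =
      *-cancelˡ det≉0 (begin
        det a b c d * s                                    ≈⟨ cramer₁ s t ⟩
        d * (s * a + t * c) - c * (s * b + t * d)          ≈⟨ +-cong (*-congˡ eq₁) (-‿cong (*-congˡ eq₂)) ⟩
        d * (s′ * a + t′ * c) - c * (s′ * b + t′ * d)      ≈⟨ cramer₁ s′ t′ ⟨
        det a b c d * s′                                   ∎) ,
      *-cancelˡ det≉0 (begin
        det a b c d * t                                    ≈⟨ cramer₂ s t ⟩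
        a * (s * b + t * d) - b * (s * a + t * c)          ≈⟨ +-cong (*-congˡ eq₂) (-‿cong (*-congˡ eq₁)) ⟩
        a * (s′ * b + t′ * d) - b * (s′ * a + t′ * c)      ≈⟨ cramer₂ s′ t′ ⟨
        det a b c d * t′                                   ∎)
      where
      cramer₁ : ∀ s t → det a b c d * s ≈ d * (s * a + t * c) - c * (s * b + t * d)
      cramer₁ s t = solve 6 (λ a b c d s t →
        (a :* d :- b :* c) :* s := d :* (s :* a :+ t :* c) :- c :* (s :* b :+ t :* d)) refl a b c d s t

      cramer₂ : ∀ s t → det a b c d * t ≈ a * (s * b + t * d) - b * (s * a + t * c)
      cramer₂ s t = solve 6 (λ a b c d s t →
        (a :* d :- b :* c) :* t := a :* (s :* b :+ t :* d) :- b :* (s :* a :+ t :* c)) refl a b c d s t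

    -- The ratio is a/c if `c` is nonzero. Otherwise `d` is nonzero, the determinant condition
    -- forces a = 0, and the ratio is b/d.
    det≈0⇒proportional : ∀ {a b c d} → ¬ (a ≈ 0# × b ≈ 0#) → ¬ (c ≈ 0# × d ≈ 0#) → det a b c d ≈ 0# →
      ∃ λ r → ¬ r ≈ 0# × a ≈ r * c × b ≈ r * d
    det≈0⇒proportional {a} {b} {c} {d} ab≉0 cd≉0 det≈0 with c ≟ 0#
    ... | no c≉0 = let c⁻¹ , cc⁻¹≈1 = inverse c c≉0 in
      finish (a * c⁻¹)
        (begin
          a                ≈⟨ *-identityʳ a ⟨
          a * 1#           ≈⟨ *-congˡ cc⁻¹≈1 ⟨
          a * (c * c⁻¹)    ≈⟨ solve 3 (λ a c c⁻¹ → a :* (c :* c⁻¹) := a :* c⁻¹ :* c) refl a c c⁻¹ ⟩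
          a * c⁻¹ * c      ∎)
        (begin
          b                ≈⟨ *-identityʳ b ⟨
          b * 1#           ≈⟨ *-congˡ cc⁻¹≈1 ⟨
          b * (c * c⁻¹)    ≈⟨ *-assoc b c c⁻¹ ⟨
          b * c * c⁻¹      ≈⟨ *-congʳ (x-y≈0⇒x≈y det≈0) ⟨
          a * d * c⁻¹      ≈⟨ solve 3 (λ a d c⁻¹ → a :* d :* c⁻¹ := a :* c⁻¹ :* d) refl a d c⁻¹ ⟩
          a * c⁻¹ * d      ∎)
      where
      finish : ∀ r → a ≈ r * c → b ≈ r * d → ∃ λ r → ¬ r ≈ 0# × a ≈ r * c × b ≈ r * d
      finish r a≈ b≈ = r , (λ r≈0 → ab≉0 (trans a≈ (trans (*-congʳ r≈0) (zeroˡ c)) ,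
                                          trans b≈ (trans (*-congʳ r≈0) (zeroˡ d)))) , a≈ , b≈
    ... | yes c≈0 = b * d⁻¹ , *-≉0 b≉0 (xy≈1⇒y≉0 dd⁻¹≈1) ,
      trans a≈0 (sym (trans (*-congˡ c≈0) (zeroʳ _))) ,
      (begin
        b                ≈⟨ *-identityʳ b ⟨
        b * 1#           ≈⟨ *-congˡ dd⁻¹≈1 ⟨
        b * (d * d⁻¹)    ≈⟨ solve 3 (λ b d d⁻¹ → b :* (d :* d⁻¹) := b :* d⁻¹ :* d) refl b d d⁻¹ ⟩
        b * d⁻¹ * d      ∎)
      where
      d≉0 : ¬ d ≈ 0#
      d≉0 d≈0 = cd≉0 (c≈0 , d≈0)
      d⁻¹ : Carrier
      d⁻¹ = proj₁ (inverse d d≉0)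
      dd⁻¹≈1 : d * d⁻¹ ≈ 1#
      dd⁻¹≈1 = proj₂ (inverse d d≉0)
      a≈0 : a ≈ 0#
      a≈0 = x*y≈0⇒y≈0 d≉0 (begin
        d * a            ≈⟨ *-comm d a ⟩
        a * d            ≈⟨ x-y≈0⇒x≈y det≈0 ⟩
        b * c            ≈⟨ *-congˡ c≈0 ⟩
        b * 0#           ≈⟨ zeroʳ b ⟩
        0#               ∎)
      b≉0 : ¬ b ≈ 0#
      b≉0 b≈0 = ab≉0 (a≈0 , b≈0)

  module _ (K : Subfield L) where
    private
      module K = Subfield K

    -- Homogeneous coordinates of a point of PG(1, K), left unnormalised; two of them are the same
    -- point when their `det` vanishes.
    record Direction : Set where
      field
        s t     : Carrier
        s∈      : s ∈ K.Mem
        t∈      : t ∈ K.Mem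
        nonzero : ¬ (s ≈ 0# × t ≈ 0#)

    open Direction

    module _ {a ℓ p} {m : ℕ} {T : Setoid a ℓ} {Q : Pred (Setoid.Carrier T) p} where
      private
        module T = Setoid T

      -- A projective line over a field of order m has the m + 1 points (1 : 0) and (κ : 1).
      pencil : (f : Direction → T.Carrier) → Enumeration setoid K.Mem m → (∀ d → f d ∈ Q) →
        (∀ d e → f d T.≈ f e → det (s d) (t d) (s e) (t e) ≈ 0#) →
        (∀ d e → det (s d) (t d) (s e) (t e) ≈ 0# → f d T.≈ f e) →
        (∀ {y} → y ∈ Q → ∃ λ d → f d T.≈ y) →
        Enumeration T Q (suc m)
      pencil f E f∈ reflects preserves onto = record
        { elt = f ∘ direction ; elt∈ = f∈ ∘ direction ; injective = direction-injective _ _ ; hits = hits }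
        where
        module E = Enumeration E

        direction : Fin (suc m) → Direction
        direction zero    = record { s∈ = K.1∈ ; t∈ = K.0∈ ; nonzero = 1≉0 ∘ proj₁ }
        direction (suc i) = record { s∈ = E.elt∈ i ; t∈ = K.1∈ ; nonzero = 1≉0 ∘ proj₂ }

        direction-injective : ∀ i j → f (direction i) T.≈ f (direction j) → i ≡ j
        direction-injective zero    zero    eq = ≡.refl
        direction-injective zero    (suc j) eq = contradiction
          (trans (solve 1 (λ x → con (+ 1) := con (+ 1) :* con (+ 1) :- con (+ 0) :* x) refl (E.elt j))
            (reflects _ _ eq)) 1≉0
        direction-injective (suc i) zero    eq = contradiction
          (trans (solve 1 (λ x → con (+ 1) := con (+ 1) :* con (+ 1) :- x :* con (+ 0)) refl (E.elt i))
            (trans (solve 1 (λ x → con (+ 1) :* con (+ 1) :- x :* con (+ 0) :=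
                                   :- (x :* con (+ 0) :- con (+ 1) :* con (+ 1))) refl (E.elt i))
              (trans (-‿cong (reflects _ _ eq)) -0#≈0#))) 1≉0
        direction-injective (suc i) (suc j) eq = ≡.cong suc (E.injective (x-y≈0⇒x≈y
          (trans (solve 2 (λ x y → x :- y := x :* con (+ 1) :- con (+ 1) :* y) refl (E.elt i) (E.elt j))
            (reflects _ _ eq))))

        hits : ∀ {y} → y ∈ Q → ∃ λ i → f (direction i) T.≈ y
        hits y∈ with onto y∈
        ... | d , fd≈y with t d ≟ 0#
        ... | yes t≈0 = zero , T.trans (preserves _ _ (trans (+-congʳ (*-congˡ t≈0))
          (solve 1 (λ x → con (+ 1) :* con (+ 0) :- con (+ 0) :* x := con (+ 0)) refl (s d)))) fd≈y
        ... | no  t≉0 =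
          let t⁻¹ , tt⁻¹≈1 = inverse (t d) t≉0
              st⁻¹∈ = K.*-∈ (s∈ d) (K.inv-∈ (t∈ d) tt⁻¹≈1) in
          suc (E.index st⁻¹∈) , T.trans (preserves _ _ (begin
            E.elt (E.index st⁻¹∈) * t d - 1# * s d  ≈⟨ +-congʳ (*-congʳ (E.elt-index st⁻¹∈)) ⟩
            s d * t⁻¹ * t d - 1# * s d
              ≈⟨ solve 3 (λ s t⁻¹ t → s :* t⁻¹ :* t :- con (+ 1) :* s := s :* (t :* t⁻¹) :- con (+ 1) :* s) refl (s d) t⁻¹ (t d) ⟩
            s d * (t d * t⁻¹) - 1# * s d            ≈⟨ +-congʳ (*-congˡ tt⁻¹≈1) ⟩
            s d * 1# - 1# * s d                     ≈⟨ solve 1 (λ s → s :* con (+ 1) :- con (+ 1) :* s := con (+ 0)) refl (s d) ⟩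
            0#                                      ∎)) fd≈y

  -- The data u, v, z of an affine plane. Independence of u and v is over L; K enters later, through
  -- the scalars that are allowed.
  record Frame : Set where
    field
      u₁ u₂ v₁ v₂ z₁ z₂ : Carrier
      det≉0             : ¬ det u₁ u₂ v₁ v₂ ≈ 0#

    dir₁ dir₂ : Carrier → Carrier → Carrier
    dir₁ s t = s * u₁ + t * v₁
    dir₂ s t = s * u₂ + t * v₂

    dir-cong₁ : ∀ {s t s′ t′} → s ≈ s′ → t ≈ t′ → dir₁ s t ≈ dir₁ s′ t′
    dir-cong₁ s≈ t≈ = +-cong (*-congʳ s≈) (*-congʳ t≈)

    dir-cong₂ : ∀ {s t s′ t′} → s ≈ s′ → t ≈ t′ → dir₂ s t ≈ dir₂ s′ t′
    dir-cong₂ s≈ t≈ = +-cong (*-congʳ s≈) (*-congʳ t≈)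

    dir-injective : ∀ {s t s′ t′} → dir₁ s t ≈ dir₁ s′ t′ → dir₂ s t ≈ dir₂ s′ t′ → s ≈ s′ × t ≈ t′
    dir-injective = det≉0⇒injective det≉0

    dir-scale₁ : ∀ r s t → dir₁ (r * s) (r * t) ≈ r * dir₁ s t
    dir-scale₁ r s t = solve 5 (λ r s t u v → r :* s :* u :+ r :* t :* v := r :* (s :* u :+ t :* v)) refl r s t u₁ v₁

    dir-scale₂ : ∀ r s t → dir₂ (r * s) (r * t) ≈ r * dir₂ s t
    dir-scale₂ r s t = solve 5 (λ r s t u v → r :* s :* u :+ r :* t :* v := r :* (s :* u :+ t :* v)) refl r s t u₂ v₂

    dir-0₁ : dir₁ 0# 0# ≈ 0#
    dir-0₁ = solve 2 (λ x y → con (+ 0) :* x :+ con (+ 0) :* y := con (+ 0)) refl u₁ v₁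

    dir-0₂ : dir₂ 0# 0# ≈ 0#
    dir-0₂ = solve 2 (λ x y → con (+ 0) :* x :+ con (+ 0) :* y := con (+ 0)) refl u₂ v₂

    dir-+₁ : ∀ s t s′ t′ → dir₁ (s + s′) (t + t′) ≈ dir₁ s t + dir₁ s′ t′
    dir-+₁ s t s′ t′ = solve 6 (λ s t s′ t′ u v →
      (s :+ s′) :* u :+ (t :+ t′) :* v := (s :* u :+ t :* v) :+ (s′ :* u :+ t′ :* v)) refl s t s′ t′ u₁ v₁

    dir-+₂ : ∀ s t s′ t′ → dir₂ (s + s′) (t + t′) ≈ dir₂ s t + dir₂ s′ t′
    dir-+₂ s t s′ t′ = solve 6 (λ s t s′ t′ u v →
      (s :+ s′) :* u :+ (t :+ t′) :* v := (s :* u :+ t :* v) :+ (s′ :* u :+ t′ :* v)) refl s t s′ t′ u₂ v₂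

    dir-≉0 : ∀ {s t} → ¬ (s ≈ 0# × t ≈ 0#) → ¬ (dir₁ s t ≈ 0# × dir₂ s t ≈ 0#)
    dir-≉0 st≉0 (eq₁ , eq₂) = st≉0 (dir-injective (trans eq₁ (sym dir-0₁)) (trans eq₂ (sym dir-0₂)))

    -- The factor `r` is any element of L. Since coordinates are unique over L, directions that
    -- differ over K cannot become proportional over L, so they give different points at infinity
    -- and different spread elements.
    proportional⇒det≈0 : ∀ {r s t s′ t′} → dir₁ s t ≈ r * dir₁ s′ t′ → dir₂ s t ≈ r * dir₂ s′ t′ →
      det s t s′ t′ ≈ 0#
    proportional⇒det≈0 {r} {s} {t} {s′} {t′} eq₁ eq₂ =
      let s≈rs′ , t≈rt′ = dir-injective (trans eq₁ (sym (dir-scale₁ r s′ t′))) (trans eq₂ (sym (dir-scale₂ r s′ t′))) in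
      trans (+-cong (*-congʳ s≈rs′) (-‿cong (*-congʳ t≈rt′)))
        (solve 3 (λ r s t → r :* s :* t :- r :* t :* s := con (+ 0)) refl r s′ t′)

    det≈0⇒dir-proportional : ∀ {s t s′ t′} → ¬ (s ≈ 0# × t ≈ 0#) → ¬ (s′ ≈ 0# × t′ ≈ 0#) → det s t s′ t′ ≈ 0# →
      ∃ λ r → ¬ r ≈ 0# × dir₁ s t ≈ r * dir₁ s′ t′ × dir₂ s t ≈ r * dir₂ s′ t′
    det≈0⇒dir-proportional st≉0 st′≉0 det≈0 =
      let r , r≉0 , s≈ , t≈ = det≈0⇒proportional st≉0 st′≉0 det≈0 in
      r , r≉0 , trans (dir-cong₁ s≈ t≈) (dir-scale₁ _ _ _) , trans (dir-cong₂ s≈ t≈) (dir-scale₂ _ _ _)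

-- Every affine K-plane is the image of a secant subplane.

module AffinePlanes (L : Field) (_≟_ : Decidable (Field._≈_ L)) (F K : Subfield L) where
  open Field L hiding (zero)
  open FieldProperties L
  open Directions L _≟_
  open Module (L³ L)
  open ABB L F
  module PG₂ where
    open Plane L public
    open LinearAlgebra L (whole L) public
  open LinearAlgebra L F using (_∼_; ∼-isEquivalence)
  module ∼ where
    open Relation.Binary.Structures.IsEquivalence ∼-isEquivalence public
  module ∼₂ where
    open Relation.Binary.Structures.IsEquivalence PG₂.∼-isEquivalence public
  module F = Subfield F
  module K = Subfield K

  ≈⇒∼ : ∀ {u v} → u ≈ᴹ v → u ∼ v
  ≈⇒∼ u≈v = 1# , F.1∈ , 1≉0 , ≈ᴹ-trans u≈v (≈ᴹ-sym (*ₗ-identityˡ _))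

  ≈⇒∼₂ : ∀ {u v} → u ≈ᴹ v → u PG₂.∼ v
  ≈⇒∼₂ u≈v = 1# , tt , 1≉0 , ≈ᴹ-trans u≈v (≈ᴹ-sym (*ₗ-identityˡ _))

  affinePoint : Frame → Carrier → Carrier → Carrierᴹ
  affinePoint fr s t = dir₁ s t + z₁ , dir₂ s t + z₂ , 1#
    where open Frame fr

  AffinePlane : Frame → PointSet
  AffinePlane fr Q = ∃₂ λ s t → s ∈ K.Mem × t ∈ K.Mem × vec Q ∼ affinePoint fr s t

  coefs : Carrier × Carrier × Carrier → Fin 3 → Carrier
  coefs (a , b , c) zero             = a
  coefs (a , b , c) (suc zero)       = b
  coefs (a , b , c) (suc (suc zero)) = c

  coefs∈ : ∀ {a b c} → a ∈ K.Mem → b ∈ K.Mem → c ∈ K.Mem → ∀ i → coefs (a , b , c) i ∈ K.Mem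
  coefs∈ a∈ b∈ c∈ zero             = a∈
  coefs∈ a∈ b∈ c∈ (suc zero)       = b∈
  coefs∈ a∈ b∈ c∈ (suc (suc zero)) = c∈

  module _ (fr : Frame) where
    open Frame fr

    frameVectors : Fin 3 → Carrierᴹ
    frameVectors zero             = u₁ , u₂ , 0#
    frameVectors (suc zero)       = v₁ , v₂ , 0#
    frameVectors (suc (suc zero)) = z₁ , z₂ , 1#

    frame-combination : ∀ s → let s₀ = s zero ; s₁ = s (suc zero) ; s₂ = s (suc (suc zero)) in
      PG₂.combination s frameVectors ≈ᴹ (dir₁ s₀ s₁ + s₂ * z₁ , dir₂ s₀ s₁ + s₂ * z₂ , s₂)
    frame-combination s = step u₁ v₁ z₁ , step u₂ v₂ z₂ ,
      solve 3 (λ s₀ s₁ s₂ → s₀ :* con (+ 0) :+ (s₁ :* con (+ 0) :+ (s₂ :* con (+ 1) :+ con (+ 0))) := s₂) refl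
        (s zero) (s (suc zero)) (s (suc (suc zero)))
      where
      step : ∀ u v z → s zero * u + (s (suc zero) * v + (s (suc (suc zero)) * z + 0#)) ≈
                       (s zero * u + s (suc zero) * v) + s (suc (suc zero)) * z
      step u v z = solve 6 (λ s₀ s₁ s₂ u v z →
        s₀ :* u :+ (s₁ :* v :+ (s₂ :* z :+ con (+ 0))) := (s₀ :* u :+ s₁ :* v) :+ s₂ :* z) refl
        (s zero) (s (suc zero)) (s (suc (suc zero))) u v z

    frameVectors-independent : PG₂.Independent frameVectors
    frameVectors-independent s s∈ eq = λ { zero → proj₁ both ; (suc zero) → proj₂ both ; (suc (suc zero)) → s₂≈0 }
      where
      eqs = ≈ᴹ-trans (≈ᴹ-sym (frame-combination s)) eq
      s₂≈0 = proj₂ (proj₂ eqs)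
      drop : ∀ {a z x y} → a + s (suc (suc zero)) * z ≈ 0# → a ≈ 0# * x + 0# * y
      drop {a} {z} {x} {y} eq = trans (solve 2 (λ a z → a := a :+ con (+ 0) :* z) refl a z)
        (trans (+-congˡ (*-congʳ (sym s₂≈0))) (trans eq
          (solve 2 (λ x y → con (+ 0) := con (+ 0) :* x :+ con (+ 0) :* y) refl x y)))
      both = dir-injective (drop (proj₁ eqs)) (drop (proj₁ (proj₂ eqs)))

    subplane : PG₂.PointSet
    subplane P = ∃ λ s → (∀ i → s i ∈ K.Mem) × ¬ (∀ i → s i ≈ 0#) × PG₂.vec P PG₂.∼ PG₂.combination s frameVectors

    private
      atInfinity : Direction K → PG₂.Point
      atInfinity d = PG₂.point (dir₁ (s d) (t d) , dir₂ (s d) (t d) , 0#) tt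
        λ (eq₁ , eq₂ , _) → dir-≉0 (nonzero d) (eq₁ , eq₂)
        where open Direction

      x+0y≈x : ∀ x y → x + 0# * y ≈ x
      x+0y≈x x y = solve 2 (λ x y → x :+ con (+ 0) :* y := x) refl x y

      atInfinity∈ : ∀ d → atInfinity d ∈ (subplane ∩ PG₂.AtInfinity)
      atInfinity∈ d = (coefs (s d , t d , 0#) , coefs∈ (s∈ d) (t∈ d) K.0∈ ,
        (λ all0 → nonzero d (all0 zero , all0 (suc zero))) ,
        ≈⇒∼₂ (≈ᴹ-sym (≈ᴹ-trans (frame-combination (coefs (s d , t d , 0#))) (x+0y≈x _ _ , x+0y≈x _ _ , refl)))) , refl
        where open Direction

      onto : ∀ {P} → P ∈ (subplane ∩ PG₂.AtInfinity) → ∃ λ d → atInfinity d PG₂.≈ᴾ P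
      onto {P} ((s , s∈ , s≉0 , r , _ , r≉0 , eq) , inf) =
        record { s∈ = s∈ zero ; t∈ = s∈ (suc zero) ; nonzero = λ (s₀≈0 , s₁≈0) →
          s≉0 λ { zero → s₀≈0 ; (suc zero) → s₁≈0 ; (suc (suc zero)) → s₂≈0 } } ,
        ∼₂.sym (r , tt , r≉0 , ≈ᴹ-trans eq (*ₗ-cong refl (≈ᴹ-trans (frame-combination s)
          (drop , drop , s₂≈0))))
        where
        s₂≈0 : s (suc (suc zero)) ≈ 0#
        s₂≈0 = x*y≈0⇒y≈0 r≉0 (trans (*-congˡ (sym (proj₂ (proj₂ (frame-combination s))))) (trans (sym (proj₂ (proj₂ eq))) inf))
        drop : ∀ {x y} → x + s (suc (suc zero)) * y ≈ x
        drop = trans (+-congˡ (*-congʳ s₂≈0)) (x+0y≈x _ _)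

    -- At infinity the coefficient of z vanishes, so what remains is the projective line of
    -- K-directions (s : t).
    subplane-secant : ∀ {m} → Enumeration setoid K.Mem m → PG₂.IsSecant m subplane
    subplane-secant E = toHasCard (pencil K {T = PG₂.pointSetoid} {Q = subplane ∩ PG₂.AtInfinity} atInfinity E
      (λ d → atInfinity∈ d)
      (λ d e (r , _ , _ , eq₁ , eq₂ , _) → proportional⇒det≈0 eq₁ eq₂)
      (λ d e det≈0 →
        let r , r≉0 , eq₁ , eq₂ = det≈0⇒dir-proportional (Direction.nonzero d) (Direction.nonzero e) det≈0 in
        r , tt , r≉0 , eq₁ , eq₂ , sym (zeroʳ r))
      (λ {P} → onto {P}))

    AffinePlane⊆φ : AffinePlane fr ⊆ φ[ subplane ∩ PG₂.Affine ]
    AffinePlane⊆φ (s , t , s∈ , t∈ , Q∼) =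
      PG₂.point (affinePoint fr s t) tt (λ (_ , _ , 1≈0) → 1≉0 1≈0) ,
      ((coefs (s , t , 1#) , coefs∈ s∈ t∈ K.1∈ , (λ all0 → 1≉0 (all0 (suc (suc zero)))) ,
        ≈⇒∼₂ (≈ᴹ-sym (≈ᴹ-trans (frame-combination (coefs (s , t , 1#)))
          (+-congˡ (*-identityˡ z₁) , +-congˡ (*-identityˡ z₂) , refl)))) , 1≉0) ,
      _ , _ , ∼₂.refl , Q∼

    private
      normalise : ∀ {r s x y z} → s * r ≈ 1# → x ≈ r * (y + s * z) → x ≈ r * y + z
      normalise {r} {s} {x} {y} {z} sr≈1 x≈ = trans x≈
        (trans (solve 4 (λ r s y z → r :* (y :+ s :* z) := r :* y :+ s :* r :* z) refl r s y z)
          (+-congˡ (trans (*-congʳ sr≈1) (*-identityˡ z))))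

    -- The last coordinate 1 of (a , b , 1) makes the factor `r`, a priori only in L, the inverse of
    -- the K-coefficient of z. Thus `r` lies in K and rescaling keeps the coefficients there.
    φ⊆AffinePlane : φ[ subplane ∩ PG₂.Affine ] ⊆ AffinePlane fr
    φ⊆AffinePlane (P , ((s , s∈ , _ , P∼) , _) , a , b , P∼ab1 , Q∼ab1) =
      let r , _ , _ , eq = ∼₂.trans (∼₂.sym P∼ab1) P∼
          eq₁ , eq₂ , eq₃ = ≈ᴹ-trans eq (*ₗ-cong refl (frame-combination s))
          s₂r≈1 = trans (*-comm _ _) (sym eq₃)
          r∈ = K.inv-∈ (s∈ (suc (suc zero))) s₂r≈1 in
      r * s zero , r * s (suc zero) , K.*-∈ r∈ (s∈ zero) , K.*-∈ r∈ (s∈ (suc zero)) ,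
      ∼.trans Q∼ab1 (≈⇒∼ (trans (normalise s₂r≈1 eq₁) (+-congʳ (sym (dir-scale₁ r (s zero) (s (suc zero))))) ,
                          trans (normalise s₂r≈1 eq₂) (+-congʳ (sym (dir-scale₂ r (s zero) (s (suc zero))))) , refl))

    plane⇒image : ∀ {m} → Enumeration setoid K.Mem m → ∀ {Π} → Π ≐ AffinePlane fr → IsImageOfSecantSubplane K m Π
    plane⇒image E (Π⊆ , Π⊇) = subplane , (frameVectors , frameVectors-independent , (λ z → z) , (λ z → z)) ,
      subplane-secant E , (λ {Q} Q∈ → AffinePlane⊆φ {Q} (Π⊆ Q∈)) , (λ {Q} Q∈ → Π⊇ (φ⊆AffinePlane {Q} Q∈))

-- The affine part of a secant subplane is an affine K-plane.

module SecantSubplanes (L : Field) (_≟_ : Decidable (Field._≈_ L)) (F K : Subfield L)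
  {N m : ℕ} (EL : Enumeration (Field.setoid L) (Subfield.Mem (whole L)) N)
  (EK : Enumeration (Field.setoid L) (Subfield.Mem K) m) where
  open Field L hiding (zero)
  open FieldProperties L
  open Directions L _≟_
  open AffinePlanes L _≟_ F K
  open Module (L³ L)
  open ABB L F
  open LinearAlgebra L F using (_∼_)
  private
    module DL = Dimension L (whole L) _≟_ EL

    S³ : Setoid 0ℓ 0ℓ
    S³ = ×-setoid setoid (×-setoid setoid setoid)

    third : Carrierᴹ → Carrier
    third = proj₂ ∘ proj₂

  module _ (e : Fin 3 → Carrierᴹ) (indep : PG₂.Independent e) where

    private
      unit : Fin 3 → Carrier × Carrier × Carrier
      unit zero             = 1# , 0# , 0#
      unit (suc zero)       = 0# , 1# , 0#
      unit (suc (suc zero)) = 0# , 0# , 1#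

      unit∈ : ∀ i j → coefs (unit i) j ∈ K.Mem
      unit∈ zero             = coefs∈ K.1∈ K.0∈ K.0∈
      unit∈ (suc zero)       = coefs∈ K.0∈ K.1∈ K.0∈
      unit∈ (suc (suc zero)) = coefs∈ K.0∈ K.0∈ K.1∈

      third-unit : ∀ i → third (PG₂.combination (coefs (unit i)) e) ≈ third (e i)
      third-unit zero             = solve 3 (λ x y z →
        con (+ 1) :* x :+ (con (+ 0) :* y :+ (con (+ 0) :* z :+ con (+ 0))) := x) refl _ _ _
      third-unit (suc zero)       = solve 3 (λ x y z →
        con (+ 0) :* x :+ (con (+ 1) :* y :+ (con (+ 0) :* z :+ con (+ 0))) := y) refl _ _ _
      third-unit (suc (suc zero)) = solve 3 (λ x y z →
        con (+ 0) :* x :+ (con (+ 0) :* y :+ (con (+ 1) :* z :+ con (+ 0))) := z) refl _ _ _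

      e₃≉0 : ∃ λ i → ¬ third (e i) ≈ 0#
      e₃≉0 with Finₚ.any? (λ i → ¬? (third (e i) ≟ 0#))
      ... | yes found = found
      ... | no  none  =
        let r , _ , eq = injection⇒surjection {S = S³} {T = S³}
              (λ r → PG₂.combination (coefs r) e) (λ _ → tt , tt , tt)
              (λ {x} {y} _ _ eq → let h = DL.independent⇒injective {e = e} {s = coefs x} {t = coefs y} indep (λ _ → tt) (λ _ → tt) eq in
                h zero , h (suc zero) , h (suc (suc zero)))
              (product EL (product EL EL)) (product EL (product EL EL)) {y = 0# , 0# , 1#} (tt , tt , tt)
            e₃≈0 = λ i → decidable-stable (third (e i) ≟ 0#) (λ e₃≉0 → none (i , e₃≉0)) in
        contradiction (trans (sym (proj₂ (proj₂ eq)))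
          (trans (+-cong (*-congˡ (e₃≈0 zero)) (+-cong (*-congˡ (e₃≈0 (suc zero))) (+-congʳ (*-congˡ (e₃≈0 (suc (suc zero)))))))
            (solve 3 (λ x y z → x :* con (+ 0) :+ (y :* con (+ 0) :+ (z :* con (+ 0) :+ con (+ 0))) := con (+ 0)) refl
              (proj₁ r) (proj₁ (proj₂ r)) (proj₂ (proj₂ r))))) 1≉0

    abstract
      affineCombination : ∃ λ d → (∀ i → d i ∈ K.Mem) × ¬ third (PG₂.combination d e) ≈ 0#
      affineCombination = let i , e₃≉0 = e₃≉0 in
        coefs (unit i) , unit∈ i , λ eq → e₃≉0 (trans (sym (third-unit i)) eq)

  module _ (e : Fin 3 → Carrierᴹ) (indep : PG₂.Independent e)
    (s s′ d : Fin 3 → Carrier)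
    (s∈ : ∀ i → s i ∈ K.Mem) (s′∈ : ∀ i → s′ i ∈ K.Mem) (d∈ : ∀ i → d i ∈ K.Mem) where

    private
      u v z : Carrierᴹ
      u = PG₂.combination s e
      v = PG₂.combination s′ e
      z = PG₂.combination d e

      -- Coordinates of x u + y v + w z with respect to `e`. The nesting and the leading `0# +`
      -- match three uses of `combination-linear`.
      recombine : Carrier × Carrier × Carrier → Fin 3 → Carrier
      recombine (x , y , w) i = ((0# + w * d i) + y * s′ i) + x * s i

      recombine∈ : ∀ {x y w} → x ∈ K.Mem → y ∈ K.Mem → w ∈ K.Mem → ∀ i → recombine (x , y , w) i ∈ K.Mem
      recombine∈ x∈ y∈ w∈ i =
        K.+-∈ (K.+-∈ (K.+-∈ K.0∈ (K.*-∈ w∈ (d∈ i))) (K.*-∈ y∈ (s′∈ i))) (K.*-∈ x∈ (s∈ i))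

      combination-recombine : ∀ x y w → PG₂.combination (recombine (x , y , w)) e ≈ᴹ w *ₗ z +ᴹ y *ₗ v +ᴹ x *ₗ u
      combination-recombine x y w =
        ≈ᴹ-trans (DL.combination-linear x (λ i → (0# + w * d i) + y * s′ i) s e) (+ᴹ-cong
          (≈ᴹ-trans (DL.combination-linear y (λ i → 0# + w * d i) s′ e) (+ᴹ-cong
            (≈ᴹ-trans (DL.combination-linear w (λ _ → 0#) d e)
              (≈ᴹ-trans (+ᴹ-cong (DL.combination-zero e) ≈ᴹ-refl) (+ᴹ-identityˡ _)))
            ≈ᴹ-refl)) ≈ᴹ-refl)

    module _ (u₃≈0 : third u ≈ 0#) (v₃≈0 : third v ≈ 0#) (z₃≉0 : ¬ third z ≈ 0#)
      (uv≉0 : ¬ det (proj₁ u) (proj₁ (proj₂ u)) (proj₁ v) (proj₁ (proj₂ v)) ≈ 0#) where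

      private
        c⁻¹ = proj₁ (inverse (third z) z₃≉0)
        cc⁻¹≈1 = proj₂ (inverse (third z) z₃≉0)

        third-recombine : ∀ x y w → third (PG₂.combination (recombine (x , y , w)) e) ≈ w * third z
        third-recombine x y w = trans (proj₂ (proj₂ (combination-recombine x y w)))
          (trans (+-cong (+-congˡ (*-congˡ v₃≈0)) (*-congˡ u₃≈0))
            (solve 4 (λ x y w c → w :* c :+ y :* con (+ 0) :+ x :* con (+ 0) := w :* c) refl x y w (third z)))

        -- Since u and v lie at infinity, the last coordinate determines `w`; Cramer's rule on the
        -- other two then determines `x` and `y`.
        recombine-injective : ∀ {x y w x′ y′ w′} →
          (∀ i → recombine (x , y , w) i ≈ recombine (x′ , y′ , w′) i) → x ≈ x′ × y ≈ y′ × w ≈ w′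
        recombine-injective {x} {y} {w} {x′} {y′} {w′} eq =
          let eqᴹ = DL.combination-cong {s = recombine (x , y , w)} {recombine (x′ , y′ , w′)} e eq
              eq₁ , eq₂ , _ = ≈ᴹ-trans (≈ᴹ-sym (combination-recombine x y w)) (≈ᴹ-trans eqᴹ (combination-recombine x′ y′ w′))
              w≈w′ = *-cancelˡ z₃≉0 (trans (*-comm _ _) (trans (trans (sym (third-recombine x y w))
                (trans (proj₂ (proj₂ eqᴹ)) (third-recombine x′ y′ w′))) (*-comm _ _)))
              x≈x′ , y≈y′ = det≉0⇒injective uv≉0 (drop w≈w′ eq₁) (drop w≈w′ eq₂) in
          x≈x′ , y≈y′ , w≈w′
          where
          drop : ∀ {a b c} → w ≈ w′ → w * c + y * b + x * a ≈ w′ * c + y′ * b + x′ * a →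
            x * a + y * b ≈ x′ * a + y′ * b
          drop {a} {b} {c} w≈w′ eq = +-cancelˡ (w * c) _ _ (trans
            (solve 6 (λ x y w a b c → w :* c :+ (x :* a :+ y :* b) := w :* c :+ y :* b :+ x :* a) refl x y w a b c)
            (trans eq (trans
              (solve 6 (λ x y w a b c → w :* c :+ y :* b :+ x :* a := w :* c :+ (x :* a :+ y :* b)) refl x′ y′ w′ a b c)
              (+-congʳ (*-congʳ (sym w≈w′))))))

        -- An injective self-map of K³ is onto.
        recombine-surjective : ∀ {r : Fin 3 → Carrier} → (∀ i → r i ∈ K.Mem) → ∃ λ x → ∃₂ λ y w →
          x ∈ K.Mem × y ∈ K.Mem × w ∈ K.Mem × (∀ i → recombine (x , y , w) i ≈ r i)
        recombine-surjective {r} r∈ =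
          unpack (injection⇒surjection {S = S³} {T = S³} {P = K³} {Q = K³}
            triple triple∈ triple-injective K³-enumeration K³-enumeration {y = r zero , r (suc zero) , r (suc (suc zero))}
            (r∈ zero , r∈ (suc zero) , r∈ (suc (suc zero))))
          where
          K³ : Pred (Carrier × Carrier × Carrier) 0ℓ
          K³ = K.Mem ⟨×⟩ K.Mem ⟨×⟩ K.Mem

          K³-enumeration : Enumeration S³ K³ (m ℕ.* (m ℕ.* m))
          K³-enumeration = product EK (product EK EK)

          triple : Carrier × Carrier × Carrier → Carrier × Carrier × Carrier
          triple a = recombine a zero , recombine a (suc zero) , recombine a (suc (suc zero))

          triple∈ : ∀ {a} → a ∈ K³ → triple a ∈ K³
          triple∈ (x∈ , y∈ , w∈) =
            recombine∈ x∈ y∈ w∈ zero , recombine∈ x∈ y∈ w∈ (suc zero) , recombine∈ x∈ y∈ w∈ (suc (suc zero))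

          triple-injective : InjectiveOn {S = S³} {T = S³} {P = K³} {Q = K³} triple
          triple-injective {x , y , w} {x′ , y′ , w′} _ _ (eq₀ , eq₁ , eq₂) =
            recombine-injective {x} {y} {w} {x′} {y′} {w′} λ { zero → eq₀ ; (suc zero) → eq₁ ; (suc (suc zero)) → eq₂ }

          unpack : (∃ λ a → a ∈ K³ × Setoid._≈_ S³ (triple a) (r zero , r (suc zero) , r (suc (suc zero)))) →
            ∃ λ x → ∃₂ λ y w → x ∈ K.Mem × y ∈ K.Mem × w ∈ K.Mem × (∀ i → recombine (x , y , w) i ≈ r i)
          unpack ((x , y , w) , (x∈ , y∈ , w∈) , eq₀ , eq₁ , eq₂) =
            x , y , w , x∈ , y∈ , w∈ , λ { zero → eq₀ ; (suc zero) → eq₁ ; (suc (suc zero)) → eq₂ }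

      -- All three vectors are divided by the last coordinate of z. A common scalar preserves the
      -- points of the K-span, whereas normalising z alone would in general change them.
      subplaneFrame : Frame
      subplaneFrame = record
        { u₁ = c⁻¹ * proj₁ u ; u₂ = c⁻¹ * proj₁ (proj₂ u)
        ; v₁ = c⁻¹ * proj₁ v ; v₂ = c⁻¹ * proj₁ (proj₂ v)
        ; z₁ = c⁻¹ * proj₁ z ; z₂ = c⁻¹ * proj₁ (proj₂ z)
        ; det≉0 = λ eq → *-≉0 (*-≉0 c⁻¹≉0 c⁻¹≉0) uv≉0 (trans
            (solve 5 (λ r a b c d → r :* r :* (a :* d :- b :* c) := (r :* a) :* (r :* d) :- (r :* b) :* (r :* c)) refl
              c⁻¹ (proj₁ u) (proj₁ (proj₂ u)) (proj₁ v) (proj₁ (proj₂ v))) eq)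
        }
        where c⁻¹≉0 = xy≈1⇒y≉0 cc⁻¹≈1

      module _ {B : PG₂.PointSet}
        (B≐ : B ≐ (λ P → ∃ λ r → (∀ i → r i ∈ K.Mem) × ¬ (∀ i → r i ≈ 0#) × PG₂.vec P PG₂.∼ PG₂.combination r e)) where

        φ⊆plane : φ[ B ∩ PG₂.Affine ] ⊆ AffinePlane subplaneFrame
        φ⊆plane (P , (P∈ , _) , a , b , P∼ab1 , Q∼ab1) =
          let r , r∈ , _ , P∼ = proj₁ B≐ P∈
              x , y , w , x∈ , y∈ , w∈ , r≈ = recombine-surjective {r} r∈
              l , _ , _ , eq = ∼₂.trans (∼₂.sym P∼ab1) P∼
              ab1≈ = ≈ᴹ-trans eq (*ₗ-cong refl (DL.combination-cong {s = r} {recombine (x , y , w)} e (λ i → sym (r≈ i))))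
              eq₁ , eq₂ , _ = ≈ᴹ-trans ab1≈ (*ₗ-cong refl (combination-recombine x y w))
              -- Last coordinates give w (l c) = 1 with `c` that of z. So l c is in K as the inverse
              -- of `w`, although `l` itself need not be.
              wlc≈1 = trans (solve 3 (λ w l c → w :* (l :* c) := l :* (w :* c)) refl w l (third z))
                (sym (trans (proj₂ (proj₂ ab1≈)) (*-congˡ (third-recombine x y w))))
              lc∈ = K.inv-∈ w∈ wlc≈1 in
          l * third z * x , l * third z * y , K.*-∈ lc∈ x∈ , K.*-∈ lc∈ y∈ ,
          ∼.trans Q∼ab1 (≈⇒∼ (scale wlc≈1 eq₁ , scale wlc≈1 eq₂ , refl))
          where
          open Relation.Binary.Reasoning.Setoid setoid
          scale : ∀ {a l x y w u v z′} → w * (l * third z) ≈ 1# → a ≈ l * (w * z′ + y * v + x * u) →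
            a ≈ l * third z * x * (c⁻¹ * u) + l * third z * y * (c⁻¹ * v) + c⁻¹ * z′
          scale {a} {l} {x} {y} {w} {u} {v} {z′} wlc≈1 a≈ = begin
            a                                          ≈⟨ a≈ ⟩
            l * (w * z′ + y * v + x * u)               ≈⟨ *-identityʳ _ ⟨
            l * (w * z′ + y * v + x * u) * 1#          ≈⟨ *-congˡ cc⁻¹≈1 ⟨
            l * (w * z′ + y * v + x * u) * (third z * c⁻¹)
              ≈⟨ solve 4 (λ l a c r → l :* a :* (c :* r) := l :* c :* (r :* a)) refl l _ (third z) c⁻¹ ⟩
            l * third z * (c⁻¹ * (w * z′ + y * v + x * u))
              ≈⟨ *-congˡ (solve 7 (λ r x y w u v z → r :* (w :* z :+ y :* v :+ x :* u) :=
                   w :* (r :* z) :+ y :* (r :* v) :+ x :* (r :* u)) refl c⁻¹ x y w u v z′) ⟩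
            l * third z * (w * (c⁻¹ * z′) + y * (c⁻¹ * v) + x * (c⁻¹ * u))
              ≈⟨ solve 7 (λ r x y w u v z → r :* (w :* z :+ y :* v :+ x :* u) :=
                   r :* x :* u :+ r :* y :* v :+ w :* r :* z) refl (l * third z) x y w (c⁻¹ * u) (c⁻¹ * v) (c⁻¹ * z′) ⟩
            l * third z * x * (c⁻¹ * u) + l * third z * y * (c⁻¹ * v) + w * (l * third z) * (c⁻¹ * z′)
              ≈⟨ +-congˡ (trans (*-congʳ wlc≈1) (*-identityˡ _)) ⟩
            l * third z * x * (c⁻¹ * u) + l * third z * y * (c⁻¹ * v) + c⁻¹ * z′  ∎

        plane⊆φ : AffinePlane subplaneFrame ⊆ φ[ B ∩ PG₂.Affine ]
        plane⊆φ (x , y , x∈ , y∈ , Q∼) =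
          PG₂.point (affinePoint subplaneFrame x y) tt (λ (_ , _ , 1≈0) → 1≉0 1≈0) ,
          (proj₂ B≐ (recombine (x , y , 1#) , recombine∈ x∈ y∈ K.1∈ ,
            -- The last coordinate of this combination is that of z, so the coefficients cannot all
            -- vanish.
            (λ all0 → z₃≉0 (trans (sym (*-identityˡ _)) (trans (sym (third-recombine x y 1#))
              (trans (proj₂ (proj₂ (DL.combination-cong {s = recombine (x , y , 1#)} {λ _ → 0#} e all0))) (proj₂ (proj₂ (DL.combination-zero e))))))) ,
            c⁻¹ , tt , xy≈1⇒y≉0 cc⁻¹≈1 ,
            ≈ᴹ-trans (scale , scale , trans (sym cc⁻¹≈1) (trans (*-comm _ _) (*-congˡ (sym (trans (third-recombine x y 1#) (*-identityˡ _))))))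
              (*ₗ-cong refl (≈ᴹ-trans (proj₁ eqs , proj₁ (proj₂ eqs) , refl) ≈ᴹ-refl))) , 1≉0) ,
          _ , _ , ∼₂.refl , Q∼
          where
          eqs = ≈ᴹ-sym (combination-recombine x y 1#)
          scale : ∀ {u v z} → x * (c⁻¹ * u) + y * (c⁻¹ * v) + c⁻¹ * z ≈ c⁻¹ * (1# * z + y * v + x * u)
          scale {u} {v} {z} = solve 6 (λ x y u v z r →
            x :* (r :* u) :+ y :* (r :* v) :+ r :* z := r :* (con (+ 1) :* z :+ y :* v :+ x :* u)) refl x y u v z c⁻¹

  image⇒plane : ∀ {Π} → 2 ≤ m → IsImageOfSecantSubplane K m Π → ∃ λ fr → Π ≐ AffinePlane fr
  -- Splitting the bound exposes the indices `zero` and `suc zero` in `Fin (suc m)`: two distinct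
  -- points at infinity.
  image⇒plane {Π} (s≤s (s≤s _)) (B , (e , indep , B≐) , secant , Π≐) =
    subplaneFrame e indep s s′ d s∈ s′∈ d∈ (at∞ {P₀} u∼ inf₀) (at∞ {P₁} v∼ inf₁) d₃≉0 uv≉0 ,
    (λ {Q} Q∈ → φ⊆plane e indep s s′ d s∈ s′∈ d∈ (at∞ {P₀} u∼ inf₀) (at∞ {P₁} v∼ inf₁) d₃≉0 uv≉0 B≐ {Q} (proj₁ Π≐ Q∈)) ,
    (λ {Q} Q∈ → proj₂ Π≐ (plane⊆φ e indep s s′ d s∈ s′∈ d∈ (at∞ {P₀} u∼ inf₀) (at∞ {P₁} v∼ inf₁) d₃≉0 uv≉0 B≐ {Q} Q∈))
    where
    open Enumeration (fromHasCard {S = PG₂.pointSetoid} {P = B ∩ PG₂.AtInfinity} secant)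
    P₀ = elt zero
    P₁ = elt (suc zero)
    inf₀ = proj₂ (elt∈ zero)
    inf₁ = proj₂ (elt∈ (suc zero))
    P₀∈ = proj₁ B≐ (proj₁ (elt∈ zero))
    P₁∈ = proj₁ B≐ (proj₁ (elt∈ (suc zero)))
    s = proj₁ P₀∈
    s∈ = proj₁ (proj₂ P₀∈)
    u∼ = proj₂ (proj₂ (proj₂ P₀∈))
    s′ = proj₁ P₁∈
    s′∈ = proj₁ (proj₂ P₁∈)
    v∼ = proj₂ (proj₂ (proj₂ P₁∈))
    d = proj₁ (affineCombination e indep)
    d∈ = proj₁ (proj₂ (affineCombination e indep))
    d₃≉0 = proj₂ (proj₂ (affineCombination e indep))

    at∞ : ∀ {P w} → PG₂.vec P PG₂.∼ w → P ∈ PG₂.AtInfinity → third w ≈ 0#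
    at∞ (_ , _ , r≉0 , _ , _ , eq₃) inf = x*y≈0⇒y≈0 r≉0 (trans (sym eq₃) inf)

    ≉0 : ∀ {P w} → PG₂.vec P PG₂.∼ w → third w ≈ 0# → ¬ (proj₁ w ≈ 0# × proj₁ (proj₂ w) ≈ 0#)
    ≉0 {P} (r , _ , _ , eq) w₃≈0 (w₁≈0 , w₂≈0) = PG₂.nonzero P
      (≈ᴹ-trans eq (≈ᴹ-trans (*ₗ-cong refl (w₁≈0 , w₂≈0 , w₃≈0)) (*ₗ-zeroʳ r)))

    uv≉0 : ¬ det (proj₁ (PG₂.combination s e)) (proj₁ (proj₂ (PG₂.combination s e)))
                 (proj₁ (PG₂.combination s′ e)) (proj₁ (proj₂ (PG₂.combination s′ e))) ≈ 0#
    uv≉0 det≈0 =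
      let u₃≈0 = at∞ {P₀} u∼ inf₀
          v₃≈0 = at∞ {P₁} v∼ inf₁
          r , r≉0 , eq₁ , eq₂ = det≈0⇒proportional (≉0 {P₀} u∼ u₃≈0) (≉0 {P₁} v∼ v₃≈0) det≈0 in
      -- If u and v were proportional, the two listed points would coincide.
      Finₚ.0≢1+n (injective {i = zero} {j = suc zero} (∼₂.trans u∼ (∼₂.trans
        (r , tt , r≉0 , eq₁ , eq₂ , trans u₃≈0 (sym (trans (*-congˡ v₃≈0) (zeroʳ r)))) (∼₂.sym v∼))))

-- Affine K-planes satisfy (i) and (ii), with sections in `𝒟 K`.

module AffinePlaneSubspaces (L : Field) (_≟_ : Decidable (Field._≈_ L)) (F K : Subfield L)
  (F⊆K : Subfield.Mem F ⊆ Subfield.Mem K) {q k : ℕ}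
  (EF : Enumeration (Field.setoid L) (Subfield.Mem F) q)
  (EK : Enumeration (Field.setoid L) (Subfield.Mem K) (q ℕ.^ suc k)) where
  open Field L hiding (zero)
  open FieldProperties L
  open Directions L _≟_
  open AffinePlanes L _≟_ F K
  open Module (L³ L)
  open ABB L F
  open LinearAlgebra L F using (_∼_; Subspace; HasDim)
  private
    module DF = Dimension L F _≟_ EF
    module ambient = Subspace ambient

  spreadElement : Carrier → Carrier → PointSet
  spreadElement a b P = ∃ λ x → x ∈ Subfield.Mem (whole L) × ¬ x ≈ 0# × vec P ∼ (a * x , b * x , 0#)

  spreadElement-⊆ : ∀ {r a b a′ b′} → ¬ r ≈ 0# → a ≈ r * a′ → b ≈ r * b′ → spreadElement a b ⊆ spreadElement a′ b′
  spreadElement-⊆ {r} r≉0 a≈ b≈ (x , _ , x≉0 , P∼) =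
    r * x , tt , *-≉0 r≉0 x≉0 , ∼.trans P∼ (≈⇒∼ (swap a≈ , swap b≈ , refl))
    where
    swap : ∀ {a a′} → a ≈ r * a′ → a * x ≈ a′ * (r * x)
    swap {_} {a′} a≈ = trans (*-congʳ a≈) (solve 3 (λ r a x → r :* a :* x := a :* (r :* x)) refl r a′ x)

  spreadElement-≐ : ∀ {r a b a′ b′} → ¬ r ≈ 0# → a ≈ r * a′ → b ≈ r * b′ → spreadElement a b ≐ spreadElement a′ b′
  spreadElement-≐ {r} r≉0 a≈ b≈ =
    let r⁻¹ , rr⁻¹≈1 = inverse r r≉0 in
    (λ {P} → spreadElement-⊆ r≉0 a≈ b≈ {P}) ,
    (λ {P} → spreadElement-⊆ (xy≈1⇒y≉0 rr⁻¹≈1) (invert rr⁻¹≈1 a≈) (invert rr⁻¹≈1 b≈) {P})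
    where
    invert : ∀ {r⁻¹ a a′} → r * r⁻¹ ≈ 1# → a ≈ r * a′ → a′ ≈ r⁻¹ * a
    invert {r⁻¹} {a} {a′} rr⁻¹≈1 a≈ = trans (sym (*-identityˡ a′)) (trans (*-congʳ (sym rr⁻¹≈1))
      (trans (solve 3 (λ r r⁻¹ a → r :* r⁻¹ :* a := r⁻¹ :* (r :* a)) refl r r⁻¹ a′) (*-congˡ (sym a≈))))

  -- The vectors of an element of `𝒟 K` together with zero. F-scalars act on them because F ⊆ K.
  multiples : Carrier → Carrier → Subspace
  multiples a b = record
    { Vectors = λ v → ∃ λ x → x ∈ K.Mem × v ≈ᴹ (a * x , b * x , 0#)
    ; respᴹ   = λ u≈v (x , x∈ , u≈) → x , x∈ , ≈ᴹ-trans (≈ᴹ-sym u≈v) u≈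
    ; 0ᴹ∈     = 0# , K.0∈ , sym (zeroʳ a) , sym (zeroʳ b) , refl
    ; +ᴹ-∈    = λ (x , x∈ , u≈) (y , y∈ , v≈) → x + y , K.+-∈ x∈ y∈ ,
        ≈ᴹ-trans (+ᴹ-cong u≈ v≈) (sym (distribˡ a x y) , sym (distribˡ b x y) , +-identityˡ 0#)
    ; *ₗ-∈    = λ {r} r∈ (x , x∈ , u≈) → r * x , K.*-∈ (F⊆K r∈) x∈ ,
        ≈ᴹ-trans (*ₗ-cong refl u≈) (swap r a x , swap r b x , zeroʳ r)
    }
    where
    swap : ∀ r a x → r * (a * x) ≈ a * (r * x)
    swap = solve 3 (λ r a x → r :* (a :* x) := a :* (r :* x)) refl

  multiples-dim : ∀ {a b} → ¬ (a ≈ 0# × b ≈ 0#) → HasDim (multiples a b) (suc k)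
  multiples-dim {a} {b} ab≉0 = DF.card⇒dim {W = multiples a b}
    (image (λ x → a * x , b * x , 0#) (λ x∈ → _ , x∈ , ≈ᴹ-refl) injective
      (λ x≈y → *-congˡ x≈y , *-congˡ x≈y , refl) (λ (x , x∈ , v≈) → x , x∈ , ≈ᴹ-sym v≈) EK)
    where
    injective : InjectiveOn {S = setoid} {T = ≈ᴹ-setoid} {P = K.Mem} {Q = Subspace.Vectors (multiples a b)}
      (λ x → a * x , b * x , 0#)
    injective _ _ (eq₁ , eq₂ , _) with a ≟ 0#
    ... | no  a≉0 = *-cancelˡ a≉0 eq₁
    ... | yes a≈0 = *-cancelˡ (λ b≈0 → ab≉0 (a≈0 , b≈0)) eq₂

  module _ (fr : Frame) where
    open Frame fr

    directions : Subspace
    directions = record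
      { Vectors = λ v → ∃₂ λ s t → s ∈ K.Mem × t ∈ K.Mem × v ≈ᴹ (dir₁ s t , dir₂ s t , 0#)
      ; respᴹ   = λ u≈v (s , t , s∈ , t∈ , u≈) → s , t , s∈ , t∈ , ≈ᴹ-trans (≈ᴹ-sym u≈v) u≈
      ; 0ᴹ∈     = 0# , 0# , K.0∈ , K.0∈ , sym dir-0₁ , sym dir-0₂ , refl
      ; +ᴹ-∈    = λ (s , t , s∈ , t∈ , u≈) (s′ , t′ , s′∈ , t′∈ , v≈) →
          s + s′ , t + t′ , K.+-∈ s∈ s′∈ , K.+-∈ t∈ t′∈ ,
          ≈ᴹ-trans (+ᴹ-cong u≈ v≈) (sym (dir-+₁ s t s′ t′) , sym (dir-+₂ s t s′ t′) , +-identityˡ 0#)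
      ; *ₗ-∈    = λ {r} r∈ (s , t , s∈ , t∈ , u≈) →
          r * s , r * t , K.*-∈ (F⊆K r∈) s∈ , K.*-∈ (F⊆K r∈) t∈ ,
          ≈ᴹ-trans (*ₗ-cong refl u≈) (sym (dir-scale₁ r s t) , sym (dir-scale₂ r s t) , zeroʳ r)
      }

    directions-dim : HasDim directions (2 ℕ.* suc k)
    directions-dim = DF.card⇒dim {W = directions} (relabel card
      (image {P = K.Mem ⟨×⟩ K.Mem} (λ (s , t) → dir₁ s t , dir₂ s t , 0#)
        (λ (s∈ , t∈) → _ , _ , s∈ , t∈ , ≈ᴹ-refl)
        (λ _ _ (eq₁ , eq₂ , _) → dir-injective eq₁ eq₂)
        (λ (s≈ , t≈) → dir-cong₁ s≈ t≈ , dir-cong₂ s≈ t≈ , refl)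
        (λ (s , t , s∈ , t∈ , v≈) → (s , t) , (s∈ , t∈) , ≈ᴹ-sym v≈)
        (product EK EK)))
      where
      card : q ℕ.^ suc k ℕ.* q ℕ.^ suc k ≡ q ℕ.^ (2 ℕ.* suc k)
      card = ≡.trans (≡.sym (ℕₚ.^-distribˡ-+-* q (suc k) (suc k)))
        (≡.cong (λ l → q ℕ.^ (suc k ℕ.+ l)) (≡.sym (ℕₚ.+-identityʳ (suc k))))

    -- The last coordinate is confined to F by the ambient space, while `s` and `t` run over K.
    -- Hence the dimension over F exceeds that of `directions` by just one.
    completion : Subspace
    completion = record
      { Vectors = λ v → ∃₂ λ s t → ∃ λ w → s ∈ K.Mem × t ∈ K.Mem × w ∈ F.Mem ×
                        v ≈ᴹ (dir₁ s t + w * z₁ , dir₂ s t + w * z₂ , w)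
      ; respᴹ   = λ u≈v (s , t , w , s∈ , t∈ , w∈ , u≈) → s , t , w , s∈ , t∈ , w∈ , ≈ᴹ-trans (≈ᴹ-sym u≈v) u≈
      ; 0ᴹ∈     = 0# , 0# , 0# , K.0∈ , K.0∈ , F.0∈ , zero-row dir-0₁ , zero-row dir-0₂ , refl
      ; +ᴹ-∈    = λ (s , t , w , s∈ , t∈ , w∈ , u≈) (s′ , t′ , w′ , s′∈ , t′∈ , w′∈ , v≈) →
          s + s′ , t + t′ , w + w′ , K.+-∈ s∈ s′∈ , K.+-∈ t∈ t′∈ , F.+-∈ w∈ w′∈ ,
          ≈ᴹ-trans (+ᴹ-cong u≈ v≈) (sum-row (dir-+₁ s t s′ t′) , sum-row (dir-+₂ s t s′ t′) , refl)
      ; *ₗ-∈    = λ {r} r∈ (s , t , w , s∈ , t∈ , w∈ , u≈) →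
          r * s , r * t , r * w , K.*-∈ (F⊆K r∈) s∈ , K.*-∈ (F⊆K r∈) t∈ , F.*-∈ r∈ w∈ ,
          ≈ᴹ-trans (*ₗ-cong refl u≈) (scale-row (dir-scale₁ r s t) , scale-row (dir-scale₂ r s t) , refl)
      }
      where
      zero-row : ∀ {x z} → x ≈ 0# → 0# ≈ x + 0# * z
      zero-row {_} {z} x≈0 = sym (trans (+-cong x≈0 (zeroˡ z)) (+-identityˡ 0#))

      sum-row : ∀ {x a b w w′ z} → x ≈ a + b → (a + w * z) + (b + w′ * z) ≈ x + (w + w′) * z
      sum-row {_} {a} {b} {w} {w′} {z} x≈ = trans
        (solve 5 (λ a b w w′ z → (a :+ w :* z) :+ (b :+ w′ :* z) := (a :+ b) :+ (w :+ w′) :* z) refl a b w w′ z)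
        (+-congʳ (sym x≈))

      scale-row : ∀ {x r a w z} → x ≈ r * a → r * (a + w * z) ≈ x + (r * w) * z
      scale-row {_} {r} {a} {w} {z} x≈ = trans
        (solve 4 (λ r a w z → r :* (a :+ w :* z) := r :* a :+ (r :* w) :* z) refl r a w z)
        (+-congʳ (sym x≈))

    completion-dim : HasDim completion (suc (2 ℕ.* suc k))
    completion-dim = DF.card⇒dim {W = completion} (image {P = F.Mem ⟨×⟩ Subspace.Vectors directions}
      (λ (w , x , y , c) → x + w * z₁ , y + w * z₂ , w)
      (λ { {w , _} (w∈ , s , t , s∈ , t∈ , eq₁ , eq₂ , _) → s , t , w , s∈ , t∈ , w∈ , +-congʳ eq₁ , +-congʳ eq₂ , refl })
      (λ { (_ , _ , _ , _ , _ , _ , _ , c≈0) (_ , _ , _ , _ , _ , _ , _ , c′≈0) (eq₁ , eq₂ , w≈) →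
           w≈ , cancel w≈ eq₁ , cancel w≈ eq₂ , trans c≈0 (sym c′≈0) })
      (λ (w≈ , x≈ , y≈ , _) → +-cong x≈ (*-congʳ w≈) , +-cong y≈ (*-congʳ w≈) , w≈)
      (λ (s , t , w , s∈ , t∈ , w∈ , v≈) → (w , dir₁ s t , dir₂ s t , 0#) , (w∈ , s , t , s∈ , t∈ , ≈ᴹ-refl) , ≈ᴹ-sym v≈)
      (product EF (DF.dim⇒card {W = directions} directions-dim)))
      where
      cancel : ∀ {w w′ x x′ z} → w ≈ w′ → x + w * z ≈ x′ + w′ * z → x ≈ x′
      cancel {_} {_} {x} {x′} w≈ eq = +-cancelʳ _ x x′ (trans eq (+-congˡ (*-congʳ (sym w≈))))

    module _ {Π : PointSet} (Π≐ : Π ≐ AffinePlane fr) where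

      plane⇒subspace : ∃ λ Π̄ → IsAffineSubspace (2 ℕ.* suc k) Π Π̄
      plane⇒subspace = (λ P → vec P ∈ Subspace.Vectors completion) ,
        (completion , inAmbient , completion-dim , (λ z → z) , (λ z → z)) ,
        (λ ⊆∞ → 1≉0 (⊆∞ {point (affinePoint fr 0# 0#) F.1∈ (1≉0 ∘ proj₂ ∘ proj₂)}
          (0# , 0# , 1# , K.0∈ , K.0∈ , F.1∈ , +-congˡ (sym (*-identityˡ z₁)) , +-congˡ (sym (*-identityˡ z₂)) , refl))) ,
        to , from
        where
        inAmbient : Subspace.Vectors completion ⊆ ambient.Vectors
        inAmbient (_ , _ , _ , _ , _ , w∈ , _ , _ , eq) = F.resp (sym eq) w∈

        to : ∀ {Q} → Q ∈ Π → vec Q ∈ Subspace.Vectors completion × ¬ proj₂ (proj₂ (vec Q)) ≈ 0#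
        to {Q} Q∈ =
          let s , t , s∈ , t∈ , r , r∈ , r≉0 , Q≈ = proj₁ Π≐ Q∈
              in-completion = Subspace.respᴹ completion (≈ᴹ-sym Q≈) (Subspace.*ₗ-∈ completion r∈
                (s , t , 1# , s∈ , t∈ , F.1∈ , +-congˡ (sym (*-identityˡ z₁)) , +-congˡ (sym (*-identityˡ z₂)) , refl)) in
          in-completion , λ Q₃≈0 → r≉0 (trans (sym (*-identityʳ r)) (trans (sym (proj₂ (proj₂ Q≈))) Q₃≈0))

        from : ∀ {Q} → vec Q ∈ Subspace.Vectors completion × ¬ proj₂ (proj₂ (vec Q)) ≈ 0# → Q ∈ Π
        from {Q} ((s , t , w , s∈ , t∈ , w∈ , Q≈) , Q₃≉0) =
          -- Dividing by `w` makes the last coordinate 1, and since 1/w lies in F ⊆ K the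
          -- coefficients stay in K.
          let w≉0 = λ w≈0 → Q₃≉0 (trans (proj₂ (proj₂ Q≈)) w≈0)
              w⁻¹ , ww⁻¹≈1 = inverse w w≉0
              w⁻¹∈ = F⊆K (F.inv-∈ w∈ ww⁻¹≈1) in
          proj₂ Π≐ (w⁻¹ * s , w⁻¹ * t , K.*-∈ w⁻¹∈ s∈ , K.*-∈ w⁻¹∈ t∈ , w , w∈ , w≉0 ,
            ≈ᴹ-trans Q≈ (divide ww⁻¹≈1 (dir-scale₁ w⁻¹ s t) , divide ww⁻¹≈1 (dir-scale₂ w⁻¹ s t) , sym (*-identityʳ w)))
          where
          divide : ∀ {w⁻¹ x x′ z} → w * w⁻¹ ≈ 1# → x′ ≈ w⁻¹ * x → x + w * z ≈ w * (x′ + z)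
          divide {w⁻¹} {x} {x′} {z} ww⁻¹≈1 x′≈ = sym (trans (*-congˡ (+-congʳ x′≈))
            (trans (solve 4 (λ w w⁻¹ x z → w :* (w⁻¹ :* x :+ z) := w :* w⁻¹ :* x :+ w :* z) refl w w⁻¹ x z)
              (+-congʳ (trans (*-congʳ ww⁻¹≈1) (*-identityˡ x)))))

      -- The final claim quantifies over every completion, so the part at infinity is recovered from
      -- Π itself and not from the particular space `completion`.
      module _ {d : ℕ} {Π̄ : PointSet} (aff : IsAffineSubspace d Π Π̄) where

        private
          W = proj₁ (proj₁ aff)
          Π̄⊆W = proj₁ (proj₂ (proj₂ (proj₂ (proj₁ aff))))
          W⊆Π̄ = proj₂ (proj₂ (proj₂ (proj₂ (proj₁ aff))))
          Π⊆Π̄ = proj₁ (proj₂ (proj₂ aff))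
          Π̄⊆Π = proj₂ (proj₂ (proj₂ aff))
          module W = Subspace W

          affine-point : Carrier → Carrier → Point
          affine-point a b = point (a , b , 1#) F.1∈ (1≉0 ∘ proj₂ ∘ proj₂)

          affine∈ : ∀ {s t} → s ∈ K.Mem → t ∈ K.Mem → affinePoint fr s t ∈ W.Vectors
          affine∈ {s} {t} s∈ t∈ =
            Π̄⊆W {affine-point (dir₁ s t + z₁) (dir₂ s t + z₂)}
              (proj₁ (Π⊆Π̄ (proj₂ Π≐ (s , t , s∈ , t∈ , ∼.refl))))

        -- A vector at infinity lies in the completion iff its translate of an
        -- affine point of Π is again in Π.
        atInfinity⇒direction : ∀ {P} → P ∈ (Π̄ ∩ H∞) → vec P ∈ Subspace.Vectors directions
        atInfinity⇒direction {P@(point (a , b , c) _ _)} (P∈ , c≈0) =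
          let Q = affine-point (a + (dir₁ 0# 0# + z₁)) (b + (dir₂ 0# 0# + z₂))
              Q∈W = W.respᴹ (refl , refl , trans (+-congʳ c≈0) (+-identityˡ 1#)) (W.+ᴹ-∈ (Π̄⊆W {P} P∈) (affine∈ K.0∈ K.0∈))
              s , t , s∈ , t∈ , r , _ , _ , eq₁ , eq₂ , eq₃ = proj₁ Π≐ (Π̄⊆Π {Q} (W⊆Π̄ {Q} Q∈W , 1≉0))
              r≈1 = sym (trans eq₃ (*-identityʳ r)) in
          s , t , s∈ , t∈ , cancel dir-0₁ r≈1 eq₁ , cancel dir-0₂ r≈1 eq₂ , c≈0
          where
          cancel : ∀ {a x y z r} → x ≈ 0# → r ≈ 1# → a + (x + z) ≈ r * (y + z) → a ≈ y
          cancel {a} {x} {y} {z} x≈0 r≈1 eq = +-cancelʳ z a y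
            (trans (+-congˡ (sym (trans (+-congʳ x≈0) (+-identityˡ z)))) (trans eq (trans (*-congʳ r≈1) (*-identityˡ _))))

        -- A direction is the difference of the affine points with parameters (s , t) and (0 , 0),
        -- both of which lie in the linear space W.
        direction⇒atInfinity : ∀ {P} → vec P ∈ Subspace.Vectors directions → P ∈ (Π̄ ∩ H∞)
        direction⇒atInfinity {P} (s , t , s∈ , t∈ , P≈) =
          W⊆Π̄ {P} (W.respᴹ (≈ᴹ-trans (difference , difference₂ , solve 0 (con (+ 1) :+ :- con (+ 1) :* con (+ 1) := con (+ 0)) refl) (≈ᴹ-sym P≈))
            (W.+ᴹ-∈ (affine∈ s∈ t∈) (W.*ₗ-∈ (F.neg-∈ F.1∈) (affine∈ K.0∈ K.0∈)))) ,
          proj₂ (proj₂ P≈)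
          where
          difference : (dir₁ s t + z₁) + - 1# * (dir₁ 0# 0# + z₁) ≈ dir₁ s t
          difference = solve 5 (λ s t u v z → (s :* u :+ t :* v :+ z) :+ :- con (+ 1) :* (con (+ 0) :* u :+ con (+ 0) :* v :+ z)
            := s :* u :+ t :* v) refl s t u₁ v₁ z₁
          difference₂ : (dir₂ s t + z₂) + - 1# * (dir₂ 0# 0# + z₂) ≈ dir₂ s t
          difference₂ = solve 5 (λ s t u v z → (s :* u :+ t :* v :+ z) :+ :- con (+ 1) :* (con (+ 0) :* u :+ con (+ 0) :* v :+ z)
            := s :* u :+ t :* v) refl s t u₂ v₂ z₂

        private
          S : PointSet
          S = Π̄ ∩ H∞

          module _ (e : Direction K) where
            open Direction e using (s; t; s∈; t∈)

            atDirection : Point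
            atDirection = point (dir₁ s t , dir₂ s t , 0#) F.0∈
              λ (eq₁ , eq₂ , _) → dir-≉0 (Direction.nonzero e) (eq₁ , eq₂)

            elementAt : PointSet
            elementAt = spreadElement (dir₁ s t) (dir₂ s t)

            atDirection∈ : atDirection ∈ elementAt
            atDirection∈ = 1# , tt , 1≉0 , ≈⇒∼ (sym (*-identityʳ _) , sym (*-identityʳ _) , refl)

            -- A common vector is μ times the direction (s , t) for some μ in L, and is also the
            -- direction (s′ , t′) with K-coordinates. Hence μ s and μ t are in K, and dividing by a
            -- nonzero one of `s`, `t` puts μ in K.
            meet⇒multiple : ∀ {Q} → Q ∈ S → Q ∈ elementAt → vec Q ∈ Subspace.Vectors (multiples (dir₁ s t) (dir₂ s t))
            meet⇒multiple {Q} Q∈S (x , _ , _ , r , _ , _ , eq₁ , eq₂ , eq₃) =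
              let s′ , t′ , s′∈ , t′∈ , Q≈₁ , Q≈₂ , _ = atInfinity⇒direction {Q} Q∈S
                  s′≈ , t′≈ = dir-injective
                    (trans (sym Q≈₁) (trans (trans eq₁ (regroup _)) (sym (dir-scale₁ (r * x) s t))))
                    (trans (sym Q≈₂) (trans (trans eq₂ (regroup _)) (sym (dir-scale₂ (r * x) s t)))) in
              r * x , divide∈ (K.resp s′≈ s′∈) (K.resp t′≈ t′∈) ,
              trans eq₁ (trans (regroup _) (*-comm _ _)) , trans eq₂ (trans (regroup _) (*-comm _ _)) , trans eq₃ (zeroʳ r)
              where
              regroup : ∀ y → r * (y * x) ≈ r * x * y
              regroup y = solve 3 (λ r x y → r :* (y :* x) := r :* x :* y) refl r x y

              quotient∈ : ∀ {μ y} → ¬ y ≈ 0# → y ∈ K.Mem → μ * y ∈ K.Mem → μ ∈ K.Mem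
              quotient∈ {μ} {y} y≉0 y∈ μy∈ = let y⁻¹ , yy⁻¹≈1 = inverse y y≉0 in
                K.resp (trans (*-assoc μ y y⁻¹) (trans (*-congˡ yy⁻¹≈1) (*-identityʳ μ))) (K.*-∈ μy∈ (K.inv-∈ y∈ yy⁻¹≈1))

              divide∈ : ∀ {μ} → μ * s ∈ K.Mem → μ * t ∈ K.Mem → μ ∈ K.Mem
              divide∈ μs∈ μt∈ with s ≟ 0#
              ... | no  s≉0 = quotient∈ s≉0 s∈ μs∈
              ... | yes s≈0 = quotient∈ (λ t≈0 → Direction.nonzero e (s≈0 , t≈0)) t∈ μt∈

            multiple-≉0 : ∀ {Q x} → vec Q ≈ᴹ (dir₁ s t * x , dir₂ s t * x , 0#) → ¬ x ≈ 0#
            multiple-≉0 {Q} Q≈ x≈0 = Point.nonzero Q (≈ᴹ-trans Q≈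
              (trans (*-congˡ x≈0) (zeroʳ _) , trans (*-congˡ x≈0) (zeroʳ _) , refl))

            multiple⇒meet : ∀ {Q} → vec Q ∈ Subspace.Vectors (multiples (dir₁ s t) (dir₂ s t)) → Q ∈ (S ∩ elementAt)
            multiple⇒meet {Q} (x , x∈ , Q≈) =
              direction⇒atInfinity {Q} (x * s , x * t , K.*-∈ x∈ s∈ , K.*-∈ x∈ t∈ , ≈ᴹ-trans Q≈
                (trans (*-comm _ _) (sym (dir-scale₁ x s t)) , trans (*-comm _ _) (sym (dir-scale₂ x s t)) , refl)) ,
              x , tt , multiple-≉0 {Q} Q≈ , ≈⇒∼ Q≈

          -- A spread element consists of the L-multiples of any of its points, so a common point of
          -- `S` and `D` already determines `D`, and its K-coordinates give the direction.
          meets⇒elementAt : ∀ {D} → D ∈ 𝒟 (whole L) → S ≬ D → ∃ λ e → elementAt e ≐ D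
          meets⇒elementAt {D} (a , b , ab≉0 , D⊆ , D⊇) (P , P∈S , P∈D) =
            let s , t , s∈ , t∈ , P≈₁ , P≈₂ , P≈₃ = atInfinity⇒direction {P} P∈S
                x , _ , x≉0 , r , _ , r≉0 , eq₁ , eq₂ , eq₃ = D⊆ P∈D
                st≉0 = λ (s≈0 , t≈0) → Point.nonzero P
                  (trans P≈₁ (trans (dir-cong₁ s≈0 t≈0) dir-0₁) , trans P≈₂ (trans (dir-cong₂ s≈0 t≈0) dir-0₂) , P≈₃)
                regroup = λ y → solve 3 (λ r x y → r :* (y :* x) := r :* x :* y) refl r x y
                e⊆ , e⊇ = spreadElement-≐ (*-≉0 r≉0 x≉0) (trans (sym P≈₁) (trans eq₁ (regroup a))) (trans (sym P≈₂) (trans eq₂ (regroup b))) in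
            record { s∈ = s∈ ; t∈ = t∈ ; nonzero = st≉0 } , (λ {Q} Q∈ → D⊇ (e⊆ {Q} Q∈)) , (λ {Q} Q∈ → e⊇ {Q} (D⊆ Q∈))

          elementAt∈ : ∀ e → elementAt e ∈ 𝒟 (whole L) × S ≬ elementAt e
          elementAt∈ e = (_ , _ , dir-≉0 (Direction.nonzero e) , (λ z → z) , (λ z → z)) ,
            atDirection e , direction⇒atInfinity {atDirection e} (s , t , s∈ , t∈ , ≈ᴹ-refl) , atDirection∈ e
            where open Direction e using (s; t; s∈; t∈)

          -- Equality of two spread elements amounts to a vanishing `det` of their directions, so
          -- those met are counted as the points of PG(1, K).
          spread-card : Enumeration (≐-setoid Point 0ℓ) (λ D → D ∈ 𝒟 (whole L) × S ≬ D) (suc (q ℕ.^ suc k))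
          spread-card = pencil K {T = ≐-setoid Point 0ℓ} {Q = λ D → D ∈ 𝒟 (whole L) × S ≬ D} elementAt EK elementAt∈
            (λ e e′ (e⊆ , _) → let x , _ , _ , r , _ , _ , eq₁ , eq₂ , _ = e⊆ {atDirection e} (atDirection∈ e) in
              proportional⇒det≈0 {r * x} (trans eq₁ (regroup r _ x)) (trans eq₂ (regroup r _ x)))
            (λ e e′ det≈0 →
              let r , r≉0 , eq₁ , eq₂ = det≈0⇒dir-proportional (Direction.nonzero e) (Direction.nonzero e′) det≈0 in
              spreadElement-≐ r≉0 eq₁ eq₂)
            (λ (D∈ , S≬D) → meets⇒elementAt D∈ S≬D)
            where
            regroup : ∀ r y x → r * (y * x) ≈ r * x * y
            regroup = solve 3 (λ r y x → r :* (y :* x) := r :* x :* y) refl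

        plane⇒meetsSpread : MeetsSpread (suc k) (q ℕ.^ suc k) (Π̄ ∩ H∞)
        plane⇒meetsSpread =
          (directions , (λ (_ , _ , _ , _ , _ , _ , eq) → F.resp (sym eq) F.0∈) , directions-dim ,
            (λ {P} → atInfinity⇒direction {P}) , (λ {P} → direction⇒atInfinity {P})) ,
          toHasCard spread-card ,
          λ D D∈ S≬D →
            let e , e⊆ , e⊇ = meets⇒elementAt D∈ S≬D
                open Direction e using (s; t) in
            multiples (dir₁ s t) (dir₂ s t) , (λ (_ , _ , _ , _ , eq) → F.resp (sym eq) F.0∈) , multiples-dim (dir-≉0 (Direction.nonzero e)) ,
            (λ {Q} (Q∈S , Q∈D) → meet⇒multiple e {Q} Q∈S (e⊇ Q∈D)) ,
            (λ {Q} Q∈ → let Q∈S , Q∈e = multiple⇒meet e {Q} Q∈ in Q∈S , e⊆ Q∈e)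

        plane⇒meets-in-𝒟ₖ : ∀ {D} → D ∈ 𝒟 (whole L) → (Π̄ ∩ H∞) ≬ D → ((Π̄ ∩ H∞) ∩ D) ∈ 𝒟 K
        plane⇒meets-in-𝒟ₖ D∈ S≬D =
          let e , e⊆ , e⊇ = meets⇒elementAt D∈ S≬D
              open Direction e using (s; t) in
          dir₁ s t , dir₂ s t , dir-≉0 (Direction.nonzero e) ,
          (λ {Q} (Q∈S , Q∈D) →
            let x , x∈ , Q≈ = meet⇒multiple e {Q} Q∈S (e⊇ Q∈D) in x , x∈ , multiple-≉0 e {Q} Q≈ , ≈⇒∼ Q≈) ,
          (λ {Q} (x , x∈ , _ , r , r∈ , _ , Q≈) →
            let Q∈S , Q∈e = multiple⇒meet e {Q} (Subspace.respᴹ (multiples (dir₁ s t) (dir₂ s t)) (≈ᴹ-sym Q≈)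
                  (Subspace.*ₗ-∈ (multiples (dir₁ s t) (dir₂ s t)) r∈ (x , x∈ , ≈ᴹ-refl)))
            in Q∈S , e⊆ Q∈e)

-- Recovering the field K from the sections with spread elements.

module SpreadSections (L : Field) (_≟_ : Decidable (Field._≈_ L)) (F K : Subfield L) {q k : ℕ}
  (EF : Enumeration (Field.setoid L) (Subfield.Mem F) q)
  (EK : Enumeration (Field.setoid L) (Subfield.Mem K) (q ℕ.^ suc k)) where
  open Field L hiding (zero)
  open FieldProperties L
  open Directions L _≟_
  open AffinePlanes L _≟_ F K
  open Module (L³ L)
  open ABB L F
  open LinearAlgebra L F using (_∼_; Subspace; HasDim)
  private
    module DF = Dimension L F _≟_ EF

    third : Carrierᴹ → Carrier
    third = proj₂ ∘ proj₂

  ray : Carrier → Carrier → Carrier → Carrierᴹ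
  ray a b x = x * a , x * b , 0#

  ray-cong : ∀ {a b x y} → x ≈ y → ray a b x ≈ᴹ ray a b y
  ray-cong x≈y = *-congʳ x≈y , *-congʳ x≈y , refl

  ray-injective : ∀ {a b x y} → ¬ (a ≈ 0# × b ≈ 0#) → ray a b x ≈ᴹ ray a b y → x ≈ y
  ray-injective {a} {b} {x} {y} ab≉0 (eq₁ , eq₂ , _) with a ≟ 0#
  ... | no  a≉0 = *-cancelˡ a≉0 (trans (*-comm a x) (trans eq₁ (*-comm y a)))
  ... | yes a≈0 = *-cancelˡ (λ b≈0 → ab≉0 (a≈0 , b≈0)) (trans (*-comm b x) (trans eq₂ (*-comm y b)))

  ray-≈0 : ∀ {a b x} → x ≈ 0# → ray a b x ≈ᴹ 0ᴹ
  ray-≈0 x≈0 = trans (*-congʳ x≈0) (zeroˡ _) , trans (*-congʳ x≈0) (zeroˡ _) , refl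

  module _ {m : ℕ} {S : PointSet} (meets : MeetsSpread (suc k) m S) (S⊆∞ : S ⊆ H∞) where
    private
      W₀ = proj₁ (proj₁ meets)
      W₀⊆ambient = proj₁ (proj₂ (proj₁ meets))
      S⊆W₀ = proj₁ (proj₂ (proj₂ (proj₂ (proj₁ meets))))
      W₀⊆S = proj₂ (proj₂ (proj₂ (proj₂ (proj₁ meets))))
      module W₀ = Subspace W₀

    W₀-enumeration : Enumeration ≈ᴹ-setoid W₀.Vectors (q ℕ.^ (2 ℕ.* suc k))
    W₀-enumeration = DF.dim⇒card {W = W₀} (proj₁ (proj₂ (proj₂ (proj₁ meets))))

    third≈0 : ∀ {v} → v ∈ W₀.Vectors → third v ≈ 0#
    third≈0 {v} v∈ with v DF.≟ᴹ 0ᴹ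
    ... | yes (_ , _ , eq) = eq
    ... | no  v≉0 = S⊆∞ (W₀⊆S {point v (W₀⊆ambient v∈) v≉0} v∈)

    -- These are A and B of the overview, and for (a , b) = u + y v also the scalars that yield the
    -- multiplication.
    Scalars : Carrier → Carrier → Pred Carrier 0ℓ
    Scalars a b x = ray a b x ∈ W₀.Vectors

    scalars-resp : ∀ {a b} → Scalars a b Respects _≈_
    scalars-resp x≈y = W₀.respᴹ (ray-cong x≈y)

    module _ {a b : Carrier} (ab≉0 : ¬ (a ≈ 0# × b ≈ 0#)) (ab∈ : (a , b , 0#) ∈ W₀.Vectors) where

      private
        D : PointSet
        D P = ∃ λ x → x ∈ Subfield.Mem (whole L) × ¬ x ≈ 0# × vec P ∼ (a * x , b * x , 0#)

        S≬D : S ≬ D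
        S≬D = point (a , b , 0#) F.0∈ (λ (a≈0 , b≈0 , _) → ab≉0 (a≈0 , b≈0)) , W₀⊆S ab∈ ,
          1# , tt , 1≉0 , ≈⇒∼ (sym (*-identityʳ a) , sym (*-identityʳ b) , refl)

        section = proj₂ (proj₂ meets) D (a , b , ab≉0 , (λ z → z) , (λ z → z)) S≬D
        W₁ = proj₁ section
        W₁⊆ambient = proj₁ (proj₂ section)
        S∩D⊆W₁ = proj₁ (proj₂ (proj₂ (proj₂ section)))
        W₁⊆S∩D = proj₂ (proj₂ (proj₂ (proj₂ section)))
        module W₁ = Subspace W₁

        ray∈W₁ : ∀ {x} → x ∈ Scalars a b → ray a b x ∈ W₁.Vectors
        ray∈W₁ {x} x∈ with x ≟ 0#
        ... | yes x≈0 = W₁.respᴹ (≈ᴹ-sym (ray-≈0 x≈0)) W₁.0ᴹ∈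
        ... | no  x≉0 = S∩D⊆W₁ {point (ray a b x) F.0∈ λ eq → x≉0 (ray-injective ab≉0 (≈ᴹ-trans eq (≈ᴹ-sym (ray-≈0 refl))))}
          (W₀⊆S x∈ , x , tt , x≉0 , ≈⇒∼ (*-comm x a , *-comm x b , refl))

        W₁⇒ray : ∀ {v} → v ∈ W₁.Vectors → ∃ λ x → x ∈ Scalars a b × ray a b x ≈ᴹ v
        W₁⇒ray {v} v∈ with v DF.≟ᴹ 0ᴹ
        ... | yes v≈0 = 0# , W₀.respᴹ (≈ᴹ-sym (ray-≈0 refl)) W₀.0ᴹ∈ , ≈ᴹ-trans (ray-≈0 refl) (≈ᴹ-sym v≈0)
        ... | no  v≉0 =
          let v∈S , x , _ , _ , r , _ , _ , eq = W₁⊆S∩D {point v (W₁⊆ambient v∈) v≉0} v∈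
              v≈ = ≈ᴹ-trans eq (regroup r a x , regroup r b x , zeroʳ r) in
          r * x , W₀.respᴹ v≈ (S⊆W₀ v∈S) , ≈ᴹ-sym v≈
          where
          regroup : ∀ r a x → r * (a * x) ≈ r * x * a
          regroup = solve 3 (λ r a x → r :* (a :* x) := r :* x :* a) refl

      abstract
        -- By (ii) the spread element through (a , b) cuts out a space of projective dimension k,
        -- that is of vector dimension `suc k`; `ray` matches its vectors with the scalars. The zero
        -- vector, which is not a point, is matched with 0 separately.
        scalars-enumeration : Enumeration setoid (Scalars a b) (q ℕ.^ suc k)
        scalars-enumeration = preimage (ray a b) ray-cong (ray-injective ab≉0) ray∈W₁ W₁⇒ray
          (DF.dim⇒card {W = W₁} (proj₁ (proj₂ (proj₂ section))))

    private
      2≤q^[2+2k] : 2 ≤ q ℕ.^ (2 ℕ.* suc k)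
      2≤q^[2+2k] = ℕₚ.≤-trans (2≤order F EF)
        (ℕₚ.m≤m*n q (q ℕ.^ (k ℕ.+ suc (k ℕ.+ 0))) {{ℕₚ.m^n≢0 q (k ℕ.+ suc (k ℕ.+ 0)) {{ℕ.>-nonZero (ℕₚ.≤-trans (s≤s z≤n) (2≤order F EF))}}}})

      nonzeroVector : ∃ λ v → v ∈ W₀.Vectors × ¬ v ≈ᴹ 0ᴹ
      nonzeroVector with distinct 2≤q^[2+2k] W₀-enumeration
      ... | x , y , x∈ , y∈ , x≉y with x DF.≟ᴹ 0ᴹ
      ... | no  x≉0 = x , x∈ , x≉0
      ... | yes x≈0 = y , y∈ , λ y≈0 → x≉y (≈ᴹ-trans x≈0 (≈ᴹ-sym y≈0))

    det≈0⇒ray : ∀ {a b c d e} → ¬ (a ≈ 0# × b ≈ 0#) → (c , d , e) ∈ W₀.Vectors → det a b c d ≈ 0# →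
      ∃ λ x → x ∈ Scalars a b × ray a b x ≈ᴹ (c , d , e)
    det≈0⇒ray {a} {b} {c} {d} {e} ab≉0 cd∈ det≈0 = onRay (r (c ≟ 0#) (d ≟ 0#))
      where
      onRay : (∃ λ x → c ≈ x * a × d ≈ x * b) → ∃ λ x → x ∈ Scalars a b × ray a b x ≈ᴹ (c , d , e)
      onRay (x , c≈ , d≈) = x , W₀.respᴹ v≈ cd∈ , ≈ᴹ-sym v≈
        where
        v≈ : (c , d , e) ≈ᴹ ray a b x
        v≈ = c≈ , d≈ , third≈0 cd∈

      proportional : ¬ (c ≈ 0# × d ≈ 0#) → ∃ λ x → c ≈ x * a × d ≈ x * b
      proportional cd≉0 =
        let x , _ , c≈ , d≈ = det≈0⇒proportional cd≉0 ab≉0 (trans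
              (solve 4 (λ a b c d → c :* b :- d :* a := :- (a :* d :- b :* c)) refl a b c d)
              (trans (-‿cong det≈0) -0#≈0#)) in
        x , c≈ , d≈

      r : Dec (c ≈ 0#) → Dec (d ≈ 0#) → ∃ λ x → c ≈ x * a × d ≈ x * b
      r (yes c≈0) (yes d≈0) = 0# , trans c≈0 (sym (zeroˡ a)) , trans d≈0 (sym (zeroˡ b))
      r (yes _)   (no d≉0)  = proportional (d≉0 ∘ proj₂)
      r (no c≉0)  _         = proportional (c≉0 ∘ proj₁)

    -- W₀ does not lie on a single spread element, since q^(2k) ≠ q^k.
    basis : ∃₂ λ a b → ∃₂ λ c d → ¬ det a b c d ≈ 0# × (a , b , 0#) ∈ W₀.Vectors × (c , d , 0#) ∈ W₀.Vectors
    basis with nonzeroVector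
    ... | (a , b , e) , ab∈ , abe≉0
      with Enumeration.search W₀-enumeration {Q = λ (c , d , _) → ¬ det a b c d ≈ 0#}
             (λ (c , d , _) → ¬? (det a b c d ≟ 0#))
             (λ (c≈ , d≈ , _) ≉0 eq → ≉0 (trans (+-cong (*-congˡ d≈) (-‿cong (*-congˡ c≈))) eq))
    ... | yes ((c , d , f) , cd∈ , det≉0) =
      a , b , c , d , det≉0 , W₀.respᴹ (refl , refl , third≈0 ab∈) ab∈ , W₀.respᴹ (refl , refl , third≈0 cd∈) cd∈
    ... | no  none = contradiction
      (^-injectiveʳ (2≤order F EF) (suc k) (2 ℕ.* suc k) (card-unique rays W₀-enumeration))
      (ℕₚ.m≢1+m+n (suc k) ∘ (λ eq → ≡.trans eq (≡.trans (≡.cong (suc k ℕ.+_) (ℕₚ.+-identityʳ (suc k))) (ℕₚ.+-suc (suc k) k))))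
      where
      ab≉0 : ¬ (a ≈ 0# × b ≈ 0#)
      ab≉0 (a≈0 , b≈0) = abe≉0 (a≈0 , b≈0 , third≈0 ab∈)

      rays : Enumeration ≈ᴹ-setoid W₀.Vectors (q ℕ.^ suc k)
      rays = image {S = setoid} {T = ≈ᴹ-setoid} (ray a b) (λ x∈ → x∈) (λ _ _ → ray-injective ab≉0) ray-cong
        (λ {v} v∈ → det≈0⇒ray ab≉0 v∈ (decidable-stable (_ ≟ 0#) (λ det≉0 → none (v , v∈ , det≉0))))
        (scalars-enumeration ab≉0 (W₀.respᴹ (refl , refl , third≈0 ab∈) ab∈))

    module _ {a b c d : Carrier} (det≉0 : ¬ det a b c d ≈ 0#)
      (ab∈ : (a , b , 0#) ∈ W₀.Vectors) (cd∈ : (c , d , 0#) ∈ W₀.Vectors) where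

      private
        A B : Pred Carrier 0ℓ
        A = Scalars a b
        B = Scalars c d

        plane : Carrier × Carrier → Carrierᴹ
        plane (x , y) = x * a + y * c , x * b + y * d , 0#

        plane∈ : ∀ {x y} → x ∈ A → y ∈ B → plane (x , y) ∈ W₀.Vectors
        plane∈ x∈ y∈ = W₀.respᴹ (refl , refl , +-identityˡ 0#) (W₀.+ᴹ-∈ x∈ y∈)

        1∈A : 1# ∈ A
        1∈A = W₀.respᴹ (sym (*-identityˡ a) , sym (*-identityˡ b) , refl) ab∈

        1∈B : 1# ∈ B
        1∈B = W₀.respᴹ (sym (*-identityˡ c) , sym (*-identityˡ d) , refl) cd∈

        0∈A : 0# ∈ A
        0∈A = W₀.respᴹ (≈ᴹ-sym (ray-≈0 refl)) W₀.0ᴹ∈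

        plane-≉0 : ∀ {x y} → ¬ (x ≈ 0# × y ≈ 0#) → ¬ (x * a + y * c ≈ 0# × x * b + y * d ≈ 0#)
        plane-≉0 xy≉0 (eq₁ , eq₂) = xy≉0 (det≉0⇒injective det≉0 (trans eq₁ (sym (zeros a c))) (trans eq₂ (sym (zeros b d))))
          where
          zeros : ∀ a c → 0# * a + 0# * c ≈ 0#
          zeros = solve 2 (λ a c → con (+ 0) :* a :+ con (+ 0) :* c := con (+ 0)) refl

        EA : Enumeration setoid A (q ℕ.^ suc k)
        EA = scalars-enumeration (λ (a≈0 , b≈0) → det≉0 (trans (+-cong (*-congʳ a≈0) (-‿cong (*-congʳ b≈0)))
          (solve 2 (λ c d → con (+ 0) :* d :- con (+ 0) :* c := con (+ 0)) refl c d))) ab∈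

        EB : Enumeration setoid B (q ℕ.^ suc k)
        EB = scalars-enumeration (λ (c≈0 , d≈0) → det≉0 (trans (+-cong (*-congˡ d≈0) (-‿cong (*-congˡ c≈0)))
          (solve 2 (λ a b → a :* con (+ 0) :- b :* con (+ 0) := con (+ 0)) refl a b))) cd∈

        -- `plane` is injective by Cramer's rule, and |A| |B| = |W₀| makes it onto.
        decompose : ∀ {v} → v ∈ W₀.Vectors → ∃ λ xy → xy ∈ (A ⟨×⟩ B) × plane xy ≈ᴹ v
        decompose = injection⇒surjection {P = A ⟨×⟩ B} plane (λ (x∈ , y∈) → plane∈ x∈ y∈)
          (λ _ _ (eq₁ , eq₂ , _) → det≉0⇒injective det≉0 eq₁ eq₂)
          (relabel card (product EA EB)) W₀-enumeration
          where
          card : q ℕ.^ suc k ℕ.* q ℕ.^ suc k ≡ q ℕ.^ (2 ℕ.* suc k)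
          card = ≡.trans (≡.sym (ℕₚ.^-distribˡ-+-* q (suc k) (suc k)))
            (≡.cong (λ l → q ℕ.^ (suc k ℕ.+ l)) (≡.sym (ℕₚ.+-identityʳ (suc k))))

        -- Here `x` and `y` are arbitrary in L. The decomposition supplies some coordinates in A and
        -- B, and uniqueness over L identifies them with `x` and `y`.
        coordinates : ∀ {x y} → plane (x , y) ∈ W₀.Vectors → x ∈ A × y ∈ B
        coordinates {x} {y} v∈ with decompose v∈
        ... | (x′ , y′) , (x′∈ , y′∈) , eq₁ , eq₂ , _ =
          let x′≈x , y′≈y = det≉0⇒injective det≉0 eq₁ eq₂ in scalars-resp x′≈x x′∈ , scalars-resp y′≈y y′∈

        -- The scalars of the spread element through u + y v form a subset of A
        -- that has the size of A.
        A*B⊆B : ∀ {x y} → x ∈ A → y ∈ B → x * y ∈ B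
        A*B⊆B {x} {y} x∈ y∈ = proj₂ (split (⊆-card⇒⊇
          (scalars-enumeration (plane-≉0 {1#} {y} (1≉0 ∘ proj₁)) (plane∈ 1∈A y∈)) EA scalars-resp (proj₁ ∘ split) x∈))
          where
          split : ∀ {x} → x ∈ Scalars (1# * a + y * c) (1# * b + y * d) → x ∈ A × x * y ∈ B
          split {x} v∈ = coordinates (W₀.respᴹ (expand a c , expand b d , refl) v∈)
            where
            expand : ∀ a c → x * (1# * a + y * c) ≈ x * a + x * y * c
            expand a c = solve 4 (λ x y a c → x :* (con (+ 1) :* a :+ y :* c) := x :* a :+ x :* y :* c) refl x y a c

        A⊆B : A ⊆ B
        A⊆B {x} x∈ = scalars-resp {c} {d} {x * 1#} {x} (*-identityʳ x) (A*B⊆B {x} {1#} x∈ 1∈B)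

        B⊆A : B ⊆ A
        B⊆A = ⊆-card⇒⊇ {S = setoid} {P = A} {Q = B} EA EB (scalars-resp {a} {b}) A⊆B

        -- The geometric product takes a factor from each of A and B and lands in B; A = B turns it
        -- into an operation on A.
        *-∈A : ∀ {x y} → x ∈ A → y ∈ A → x * y ∈ A
        *-∈A {x} {y} x∈ y∈ = B⊆A {x * y} (A*B⊆B {x} {y} x∈ (A⊆B {y} y∈))

        A⊆K : A ⊆ K.Mem
        A⊆K {x} x∈ = x^N≈x⇒x∈ _≟_ K EK (x^N≈x {P = A} (λ {x} {y} → *-∈A {x} {y}) 0∈A EA {x} x∈)

        K⊆A : K.Mem ⊆ A
        K⊆A = ⊆-card⇒⊇ {S = setoid} {P = A} {Q = K.Mem} EA EK (scalars-resp {a} {b}) A⊆K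

      W₀⇒combination : ∀ {v} → v ∈ W₀.Vectors → ∃₂ λ s t → s ∈ K.Mem × t ∈ K.Mem × v ≈ᴹ (s * a + t * c , s * b + t * d , 0#)
      W₀⇒combination v∈ with decompose v∈
      ... | (x , y) , (x∈ , y∈) , eq = x , y , A⊆K x∈ , A⊆K (B⊆A y∈) , ≈ᴹ-sym eq

      combination⇒W₀ : ∀ {s t} → s ∈ K.Mem → t ∈ K.Mem → (s * a + t * c , s * b + t * d , 0#) ∈ W₀.Vectors
      combination⇒W₀ s∈ t∈ = plane∈ (K⊆A s∈) (A⊆B (K⊆A t∈))

  module _ {l m : ℕ} {Π Π̄ : PointSet} (aff : IsAffineSubspace l Π Π̄) (meets : MeetsSpread (suc k) m (Π̄ ∩ H∞)) where
    private
      W = proj₁ (proj₁ aff)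
      W⊆ambient = proj₁ (proj₂ (proj₁ aff))
      Π̄⊆W = proj₁ (proj₂ (proj₂ (proj₂ (proj₁ aff))))
      W⊆Π̄ = proj₂ (proj₂ (proj₂ (proj₂ (proj₁ aff))))
      Π̄⊈∞ = proj₁ (proj₂ aff)
      Π⊆ = proj₁ (proj₂ (proj₂ aff))
      Π⊇ = proj₂ (proj₂ (proj₂ aff))
      W₀ = proj₁ (proj₁ meets)
      W₀⊆ambient = proj₁ (proj₂ (proj₁ meets))
      S⊆W₀ = proj₁ (proj₂ (proj₂ (proj₂ (proj₁ meets))))
      W₀⊆S = proj₂ (proj₂ (proj₂ (proj₂ (proj₁ meets))))
      module W = Subspace W
      module W₀ = Subspace W₀

      W₀⊆W : W₀.Vectors ⊆ W.Vectors
      W₀⊆W {v} v∈ with v DF.≟ᴹ 0ᴹ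
      ... | yes v≈0 = W.respᴹ (≈ᴹ-sym v≈0) W.0ᴹ∈
      ... | no  v≉0 = Π̄⊆W (proj₁ (W₀⊆S {point v (W₀⊆ambient v∈) v≉0} v∈))

      W∩∞⊆W₀ : ∀ {v} → v ∈ W.Vectors → third v ≈ 0# → v ∈ W₀.Vectors
      W∩∞⊆W₀ {v} v∈ v₃≈0 with v DF.≟ᴹ 0ᴹ
      ... | yes v≈0 = W₀.respᴹ (≈ᴹ-sym v≈0) W₀.0ᴹ∈
      ... | no  v≉0 = S⊆W₀ {point v (W⊆ambient v∈) v≉0} (W⊆Π̄ v∈ , v₃≈0)

      -- That Π̄ is not contained in H∞ is only a negation; a search through the finitely many
      -- vectors of W turns it into a witness, which is then scaled by an element of F.
      affineVector : ∃₂ λ z₁ z₂ → (z₁ , z₂ , 1#) ∈ W.Vectors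
      affineVector with Enumeration.search (DF.dim⇒card {W = W} (proj₁ (proj₂ (proj₂ (proj₁ aff)))))
                          {Q = λ v → ¬ third v ≈ 0#} (λ v → ¬? (third v ≟ 0#))
                          (λ (_ , _ , eq) ≉0 y≈0 → ≉0 (trans eq y≈0))
      ... | yes (v , v∈ , v₃≉0) =
        let r , v₃r≈1 = inverse (third v) v₃≉0 in
        r * proj₁ v , r * proj₁ (proj₂ v) , W.respᴹ (refl , refl , trans (*-comm r (third v)) v₃r≈1)
          (W.*ₗ-∈ (F.inv-∈ (W⊆ambient v∈) v₃r≈1) v∈)
      ... | no none = contradiction
        (λ {P} P∈ → decidable-stable (third (vec P) ≟ 0#) (λ P₃≉0 → none (vec P , Π̄⊆W P∈ , P₃≉0))) Π̄⊈∞

    section⇒plane : ∃ λ fr → Π ≐ AffinePlane fr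
    section⇒plane with basis meets proj₂ | affineVector
    ... | a , b , c , d , det≉0 , ab∈ , cd∈ | z₁ , z₂ , z∈ = fr , to , from
      where
      fr : Frame
      fr = record { u₁ = a ; u₂ = b ; v₁ = c ; v₂ = d ; z₁ = z₁ ; z₂ = z₂ ; det≉0 = det≉0 }

      to : Π ⊆ AffinePlane fr
      to {Q} Q∈ = s , t , s∈ , t∈ , third (vec Q) , vec∈ Q , q₃≉0 ,
        rebuild eq₁ , rebuild eq₂ , sym (*-identityʳ (third (vec Q)))
        where
        q₃≉0 = proj₂ (Π⊆ Q∈)
        r = proj₁ (inverse (third (vec Q)) q₃≉0)
        q₃r≈1 = proj₂ (inverse (third (vec Q)) q₃≉0)

        -- Scaling `Q` to last coordinate 1 and subtracting the origin z gives a vector of W at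
        -- infinity. The scalar `r` is in F because the last coordinate of `Q` is.
        translate∈ : r *ₗ vec Q +ᴹ - 1# *ₗ (z₁ , z₂ , 1#) ∈ W₀.Vectors
        translate∈ = W∩∞⊆W₀
          (W.+ᴹ-∈ (W.*ₗ-∈ (F.inv-∈ (vec∈ Q) q₃r≈1) (Π̄⊆W (proj₁ (Π⊆ Q∈)))) (W.*ₗ-∈ (F.neg-∈ F.1∈) z∈))
          (trans (+-congʳ (trans (*-comm r (third (vec Q))) q₃r≈1))
            (solve 0 (con (+ 1) :+ :- con (+ 1) :* con (+ 1) := con (+ 0)) refl))

        combination = W₀⇒combination meets proj₂ det≉0 ab∈ cd∈ translate∈
        s = proj₁ combination
        t = proj₁ (proj₂ combination)
        s∈ = proj₁ (proj₂ (proj₂ combination))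
        t∈ = proj₁ (proj₂ (proj₂ (proj₂ combination)))
        eq₁ = proj₁ (proj₂ (proj₂ (proj₂ (proj₂ combination))))
        eq₂ = proj₁ (proj₂ (proj₂ (proj₂ (proj₂ (proj₂ combination)))))

        rebuild : ∀ {x y z} → r * x + - 1# * z ≈ y → x ≈ third (vec Q) * (y + z)
        rebuild {x} {y} {z} eq = sym (trans (*-congˡ (+-congʳ (sym eq))) (trans
          (solve 4 (λ w r x z → w :* (r :* x :+ :- con (+ 1) :* z :+ z) := w :* r :* x) refl (third (vec Q)) r x z)
          (trans (*-congʳ q₃r≈1) (*-identityˡ x))))

      from : AffinePlane fr ⊆ Π
      from {Q} (s , t , s∈ , t∈ , r , r∈ , r≉0 , Q≈) = Π⊇ (W⊆Π̄ (W.respᴹ (≈ᴹ-sym Q≈) (W.*ₗ-∈ r∈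
          (W.respᴹ (refl , refl , +-identityˡ 1#) (W.+ᴹ-∈ (W₀⊆W (combination⇒W₀ meets proj₂ det≉0 ab∈ cd∈ s∈ t∈)) z∈)))) ,
        λ Q₃≈0 → r≉0 (trans (sym (*-identityʳ r)) (trans (sym (proj₂ (proj₂ Q≈))) Q₃≈0)))

-- Both directions joined through affine K-planes.

module Equivalence (L : Field) (_≟_ : Decidable (Field._≈_ L)) (F K : Subfield L) {N q k : ℕ}
  (EL : Enumeration (Field.setoid L) (Subfield.Mem (whole L)) N)
  (EF : Enumeration (Field.setoid L) (Subfield.Mem F) q)
  (EK : Enumeration (Field.setoid L) (Subfield.Mem K) (q ℕ.^ suc k)) where
  open ABB L F
  private
    F⊆K : Subfield.Mem F ⊆ Subfield.Mem K
    F⊆K = FieldProperties.subfield-⊆ L _≟_ (suc k) F K EF EK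

    2≤∣K∣ : 2 ≤ q ℕ.^ suc k
    2≤∣K∣ = FieldProperties.2≤order L K EK

    module Planes = AffinePlanes L _≟_ F K
    module Subspaces = AffinePlaneSubspaces L _≟_ F K F⊆K {k = k} EF EK

    plane⇒section : ∀ {Π} → (∃ λ fr → Π ≐ Planes.AffinePlane fr) →
      ∃ λ Π̄ → IsAffineSubspace (2 ℕ.* suc k) Π Π̄ × MeetsSpread (suc k) (q ℕ.^ suc k) (Π̄ ∩ H∞)
    plane⇒section {Π} (fr , Π≐) = let Π̄ , aff = Subspaces.plane⇒subspace fr {Π} Π≐ in
      Π̄ , aff , Subspaces.plane⇒meetsSpread fr {Π} Π≐ aff

    plane⇒meets-in-𝒟ₖ : ∀ {Π} → (∃ λ fr → Π ≐ Planes.AffinePlane fr) →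
      ∀ Π̄ → IsAffineSubspace (2 ℕ.* suc k) Π Π̄ →
      ∀ D → D ∈ 𝒟 (whole L) → (Π̄ ∩ H∞) ≬ D → ((Π̄ ∩ H∞) ∩ D) ∈ 𝒟 K
    plane⇒meets-in-𝒟ₖ {Π} (fr , Π≐) Π̄ aff D = Subspaces.plane⇒meets-in-𝒟ₖ fr {Π} Π≐ {Π̄ = Π̄} aff {D}

  image⇒section : ∀ {Π} → IsImageOfSecantSubplane K (q ℕ.^ suc k) Π →
    ∃ λ Π̄ → IsAffineSubspace (2 ℕ.* suc k) Π Π̄ × MeetsSpread (suc k) (q ℕ.^ suc k) (Π̄ ∩ H∞)
  image⇒section {Π} image = plane⇒section {Π} (SecantSubplanes.image⇒plane L _≟_ F K EL EK {Π} 2≤∣K∣ image)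

  section⇒image : ∀ {Π} → (∃ λ Π̄ → IsAffineSubspace (2 ℕ.* suc k) Π Π̄ × MeetsSpread (suc k) (q ℕ.^ suc k) (Π̄ ∩ H∞)) →
    IsImageOfSecantSubplane K (q ℕ.^ suc k) Π
  section⇒image {Π} (Π̄ , aff , meets) =
    let fr , Π≐ = SpreadSections.section⇒plane L _≟_ F K {k = k} EF EK {Π = Π} {Π̄} aff meets in
    Planes.plane⇒image fr EK {Π} Π≐

  image⇒meets-in-𝒟ₖ : ∀ {Π} → IsImageOfSecantSubplane K (q ℕ.^ suc k) Π →
    ∀ Π̄ → IsAffineSubspace (2 ℕ.* suc k) Π Π̄ →
    ∀ D → D ∈ 𝒟 (whole L) → (Π̄ ∩ H∞) ≬ D → ((Π̄ ∩ H∞) ∩ D) ∈ 𝒟 K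
  image⇒meets-in-𝒟ₖ {Π} image = plane⇒meets-in-𝒟ₖ {Π} (SecantSubplanes.image⇒plane L _≟_ F K EL EK {Π} 2≤∣K∣ image)


open import Data.Nat using (_*_; _^_)
open import Data.Nat.Divisibility using (_∣_; 0∣⇒≡0)

theorem3p1 : (q n k : ℕ) → PrimePower q → 1 ≤ n → k ∣ n →
    (L : Field) → HasOrder L (whole L) (q ^ n) →
    (Fq Fqk : Subfield L) → HasOrder L Fq q → HasOrder L Fqk (q ^ k) →
    let open ABB L Fq in
    (Π : PointSet) → Π Respects _≈ᴾ_ → Π ⊆ Affine →
    (IsImageOfSecantSubplane Fqk (q ^ k) Π ⇔
      (∃ λ (Π̄ : PointSet) → IsAffineSubspace (2 * k) Π Π̄ × MeetsSpread k (q ^ k) (Π̄ ∩ H∞)))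
    × (IsImageOfSecantSubplane Fqk (q ^ k) Π →
        ∀ (Π̄ : PointSet) → IsAffineSubspace (2 * k) Π Π̄ →
        ∀ (D : PointSet) → D ∈ 𝒟 (whole L) → (Π̄ ∩ H∞) ≬ D → ((Π̄ ∩ H∞) ∩ D) ∈ 𝒟 Fqk)
-- 0 divides n only for n = 0, so from here on k is a successor and `pred k` is a true k - 1.
theorem3p1 q n zero _ 1≤n 0∣n = contradiction (≡.subst (1 ≤_) (0∣⇒≡0 0∣n) 1≤n) λ ()
theorem3p1 q n (suc k) _ _ _ L cardL Fq Fqk cardFq cardFqk Π _ _ =
  mk⇔ image⇒section section⇒image , image⇒meets-in-𝒟ₖ
  where
  EL : Enumeration (Field.setoid L) (Subfield.Mem (whole L)) (q ^ n)
  EL = fromHasCard {S = Field.setoid L} {P = Subfield.Mem (whole L)} cardL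
  EF : Enumeration (Field.setoid L) (Subfield.Mem Fq) q
  EF = fromHasCard {S = Field.setoid L} {P = Subfield.Mem Fq} cardFq
  EK : Enumeration (Field.setoid L) (Subfield.Mem Fqk) (q ^ suc k)
  EK = fromHasCard {S = Field.setoid L} {P = Subfield.Mem Fqk} cardFqk
  -- Membership in the whole field is trivial, so the enumeration of L decides equality of any two
  -- elements.
  open Equivalence L (λ x y → decidable EL {x} {y} tt tt) Fq Fqk {k = k} EL EF EK
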